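{- Let $r\ge 3$ be a fixed integer. Then almost all $r$-regular graphs have proper connection number $2$; that is, the number of $r$-regular graphs on $n$ labeled vertices that are connected and have $pc(G)=2$, divided by the total number of $r$-regular graphs on these $n$ labeled vertices, tends to $1$ as $n\to\infty$ (through those $n$ for which $r$-regular graphs on $n$ vertices exist).
   Context: All graphs are finite, simple and undirected. In an edge-colored graph (adjacent edges may receive the same color), a path is proper if no two adjacent edges of the path have the same color. For a nontrivial connected graph $G$, the proper connection number $pc(G)$ is the minimum number of colors in an edge-coloring of $G$ such that every two distinct vertices of $G$ are connected by at least one proper path. -}

module Defs where

open import Data.Bool.Base using (true; false)
open import Data.Fin.Base using (Fin; zero; suc)
open import Data.Fin.Properties as Fin using (injective⇒≤)
open import Data.Fin.Subset using (Subset; inside; outside; _∈_; _∉_; ∣_∣)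
open import Data.Fin.Subset.Properties using (_∈?_)
open import Data.List.Base
  using (List; []; _∷_; length; head; last; lookup; filter; cartesianProductWith; mapMaybe; allFin)
open import Data.List.Membership.Propositional as List using (find; lose)
open import Data.List.Membership.Propositional.Properties
  using (∈-cartesianProductWith⁺; ∈-allFin; ∈-lookup)
open import Data.List.Relation.Unary.All as All using (All; []; _∷_)
open import Data.List.Relation.Unary.Any using (any?; here; there)
open import Data.List.Relation.Unary.AllPairs using ([]; _∷_)
open import Data.List.Relation.Unary.Linked using (Linked; linked?)
open import Data.List.Relation.Unary.Unique.DecPropositional using (unique?)
open import Data.List.Relation.Unary.Unique.Propositional using (Unique)
open import Data.List.Relation.Unary.Unique.Propositional.Properties
  using (cartesianProductWith⁺)
open import Data.Maybe.Base using (Maybe; just; nothing)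
import Data.Maybe.Properties as Maybe
open import Data.Nat.Base using (ℕ; zero; suc; _≤_; _<_; s≤s)
import Data.Nat.Properties as ℕ
open import Data.Product.Base using (Σ; ∃; _×_; _,_; proj₁; proj₂)
open import Data.Vec.Base as Vec using (Vec; []; _∷_; tabulate; toList; fromList)
open import Data.Vec.Properties using (lookup∘tabulate; toList∘fromList; ∷-injective)
open import Function.Base using (_∘_)
open import Relation.Binary.PropositionalEquality
  using (_≡_; _≢_; refl; sym; trans; cong; cong₂; subst)
open import Relation.Nullary
  using (¬_; Dec; yes; no; ¬?; _×-dec_; _→-dec_; recompute; contradiction)
open import Relation.Nullary.Decidable using (map′)
open import Relation.Unary using (Pred; Decidable)
open import Level using (0ℓ)

-- A graph on the vertex set Fin n is the vector of its neighbourhoods.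

Symmetric Loopless : ∀ {n} → Pred (Vec (Subset n) n) 0ℓ
Symmetric N = ∀ u v → v ∈ Vec.lookup N u → u ∈ Vec.lookup N v
Loopless  N = ∀ u → u ∉ Vec.lookup N u

symmetric? : ∀ {n} → Decidable (Symmetric {n})
symmetric? N = Fin.all? λ u → Fin.all? λ v →
  (v ∈? Vec.lookup N u) →-dec (u ∈? Vec.lookup N v)

loopless? : ∀ {n} → Decidable (Loopless {n})
loopless? N = Fin.all? λ u → ¬? (u ∈? Vec.lookup N u)

-- The laws are irrelevant so that _≡_ is equality of labelled graphs.

record Graph (n : ℕ) : Set where
  constructor mkGraph
  field
    neighbours : Vec (Subset n) n
    .symmetric : Symmetric neighbours
    .loopless  : Loopless neighbours

open Graph public using (neighbours)

N : ∀ {n} → Graph n → Fin n → Subset n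
N G u = Vec.lookup (neighbours G) u

Adj : ∀ {n} → Graph n → Fin n → Fin n → Set
Adj G u v = v ∈ N G u

adj? : ∀ {n} (G : Graph n) u v → Dec (Adj G u v)
adj? G u v = v ∈? N G u

adj-sym : ∀ {n} (G : Graph n) → Symmetric (neighbours G)
adj-sym (mkGraph M s _) = recompute (symmetric? M) s

adj-irrefl : ∀ {n} (G : Graph n) → Loopless (neighbours G)
adj-irrefl (mkGraph M _ l) = recompute (loopless? M) l

Regular : ∀ {n} → ℕ → Graph n → Set
Regular r G = ∀ u → ∣ N G u ∣ ≡ r

record IsPath {n} (G : Graph n) (u v : Fin n) (p : List (Fin n)) : Set where
  field
    linked   : Linked (Adj G) p
    distinct : Unique p
    starts   : head p ≡ just u
    ends     : last p ≡ just v

Connected : ∀ {n} → Graph n → Set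
Connected G = ∀ u v → ∃ (IsPath G u v)

-- The values of colour off the edges are never used; they only matter in
-- that there is no colouring with 0 colours even when G has a vertex but
-- no edge, which cannot occur for a nontrivial connected graph.

record EdgeColouring {n} (G : Graph n) (k : ℕ) : Set where
  field
    colour     : Fin n → Fin n → Fin k
    colour-sym : ∀ u v → Adj G u v → colour u v ≡ colour v u

open EdgeColouring public

edgeColours : ∀ {n} {C : Set} → (Fin n → Fin n → C) → List (Fin n) → List C
edgeColours c []          = []
edgeColours c (x ∷ [])    = []
edgeColours c (x ∷ y ∷ p) = c x y ∷ edgeColours c (y ∷ p)

Proper : ∀ {n k} {G : Graph n} → EdgeColouring G k → List (Fin n) → Set
Proper c p = Linked _≢_ (edgeColours (colour c) p)

ProperlyConnecting : ∀ {n k} {G : Graph n} → EdgeColouring G k → Set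
ProperlyConnecting {G = G} c =
  ∀ u v → u ≢ v → ∃ λ p → IsPath G u v p × Proper c p

ProperlyConnectable : ∀ {n} → ℕ → Graph n → Set
ProperlyConnectable k G = Σ (EdgeColouring G k) ProperlyConnecting

-- pc(G) = k.  (A graph with at most one vertex never has pc(G) = 2.)
ProperConnectionNumber : ∀ {n} → ℕ → Graph n → Set
ProperConnectionNumber k G =
  ProperlyConnectable k G × (∀ {j} → j < k → ¬ ProperlyConnectable j G)

vecs : ∀ {A : Set} → List A → ∀ m → List (Vec A m)
vecs xs zero    = [] ∷ []
vecs xs (suc m) = cartesianProductWith _∷_ xs (vecs xs m)

∈-vecs : ∀ {A : Set} {xs : List A} → (∀ x → x List.∈ xs) →
         ∀ {m} (v : Vec A m) → v List.∈ vecs xs m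
∈-vecs all []      = here refl
∈-vecs all (x ∷ v) = ∈-cartesianProductWith⁺ _∷_ (all x) (∈-vecs all v)

vecs-unique : ∀ {A : Set} {xs : List A} → Unique xs → ∀ m → Unique (vecs xs m)
vecs-unique xs! zero    = [] ∷ []
vecs-unique xs! (suc m) =
  cartesianProductWith⁺ _∷_ ∷-injective xs! (vecs-unique xs! m)

∃? : ∀ {A : Set} {xs : List A} → (∀ x → x List.∈ xs) →
     {P : Pred A 0ℓ} → Decidable P → Dec (∃ P)
∃? {xs = xs} all P? =
  map′ (λ a → let x , _ , px = find a in x , px) (λ (x , px) → lose (all x) px)
       (any? P? xs)

subsets : ∀ n → List (Subset n)
subsets = vecs (outside ∷ inside ∷ [])

∈-subsets : ∀ {n} (s : Subset n) → s List.∈ subsets n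
∈-subsets = ∈-vecs λ { false → here refl ; true → there (here refl) }

subsets-unique : ∀ n → Unique (subsets n)
subsets-unique = vecs-unique (((λ ()) ∷ []) ∷ [] ∷ [])

toGraph : ∀ {n} → Vec (Subset n) n → Maybe (Graph n)
toGraph M with symmetric? M | loopless? M
... | yes s | yes l = just (mkGraph M s l)
... | _     | _     = nothing

graphs : ∀ n → List (Graph n)
graphs n = mapMaybe toGraph (vecs (subsets n) n)

private
  toGraph-neighbours : ∀ {n} (G : Graph n) → toGraph (neighbours G) ≡ just G
  toGraph-neighbours G with symmetric? (neighbours G) | loopless? (neighbours G)
  ... | yes _ | yes _ = refl
  ... | no ¬s | _     = contradiction (adj-sym G) ¬s
  ... | yes _ | no ¬l = contradiction (adj-irrefl G) ¬l

  neighbours-toGraph : ∀ {n} (M : Vec (Subset n) n) {G} →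
                       toGraph M ≡ just G → neighbours G ≡ M
  neighbours-toGraph M eq with symmetric? M | loopless? M
  neighbours-toGraph M refl | yes _ | yes _ = refl

  ∈-mapMaybe : ∀ {A B : Set} (f : A → Maybe B) {xs x y} →
               x List.∈ xs → f x ≡ just y → y List.∈ mapMaybe f xs
  ∈-mapMaybe f {x ∷ xs} (here refl) eq with f x
  ∈-mapMaybe f {x ∷ xs} (here refl) refl | just _ = here refl
  ∈-mapMaybe f {x ∷ xs} (there i) eq with f x
  ... | just _  = there (∈-mapMaybe f i eq)
  ... | nothing = ∈-mapMaybe f i eq

  graphs-fresh : ∀ {n} {M : Vec (Subset n) n} {G Ms} → neighbours G ≡ M →
                 All (M ≢_) Ms → All (G ≢_) (mapMaybe toGraph Ms)
  graphs-fresh eq [] = []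
  graphs-fresh {Ms = M′ ∷ _} eq (M≢ ∷ rest) with toGraph M′ in eq′
  ... | nothing = graphs-fresh eq rest
  ... | just G′ =
    (λ { refl → M≢ (trans (sym eq) (neighbours-toGraph M′ eq′)) })
    ∷ graphs-fresh eq rest

  mapMaybe-unique : ∀ {n} {Ms : List (Vec (Subset n) n)} →
                    Unique Ms → Unique (mapMaybe toGraph Ms)
  mapMaybe-unique [] = []
  mapMaybe-unique {Ms = M ∷ _} (M∉ ∷ Ms!) with toGraph M in eq
  ... | nothing = mapMaybe-unique Ms!
  ... | just G  = graphs-fresh (neighbours-toGraph M eq) M∉ ∷ mapMaybe-unique Ms!

∈-graphs : ∀ {n} (G : Graph n) → G List.∈ graphs n
∈-graphs G =
  ∈-mapMaybe toGraph (∈-vecs ∈-subsets (neighbours G)) (toGraph-neighbours G)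

graphs-unique : ∀ n → Unique (graphs n)
graphs-unique n = mapMaybe-unique (vecs-unique (subsets-unique n) n)

regular? : ∀ {n} r → Decidable (Regular {n} r)
regular? r G = Fin.all? λ u → ∣ N G u ∣ ℕ.≟ r

isPath? : ∀ {n} (G : Graph n) u v → Decidable (IsPath G u v)
isPath? G u v p =
  map′ (λ (l , d , s , e) → record { linked = l ; distinct = d ; starts = s ; ends = e })
       (λ π → let open IsPath π in linked , distinct , starts , ends)
       (linked? (adj? G) p
         ×-dec unique? Fin._≟_ p
         ×-dec Maybe.≡-dec Fin._≟_ (head p) (just u)
         ×-dec Maybe.≡-dec Fin._≟_ (last p) (just v))

lookup-injective : ∀ {A : Set} {xs : List A} → Unique xs →
                   ∀ i j → lookup xs i ≡ lookup xs j → i ≡ j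
lookup-injective (_ ∷ _)     zero    zero    _  = refl
lookup-injective (x∉ ∷ _)    zero    (suc j) eq = contradiction eq (All.lookup x∉ (∈-lookup j))
lookup-injective (x∉ ∷ _)    (suc i) zero    eq = contradiction (sym eq) (All.lookup x∉ (∈-lookup i))
lookup-injective (_ ∷ xs!)   (suc i) (suc j) eq = cong suc (lookup-injective xs! i j eq)

unique⇒length≤ : ∀ {n} {p : List (Fin n)} → Unique p → length p ≤ n
unique⇒length≤ {p = p} p! = injective⇒≤ {f = lookup p} (λ {i} {j} → lookup-injective p! i j)

∃path? : ∀ {n} (G : Graph n) u v {P : Pred (List (Fin n)) 0ℓ} → Decidable P →
         Dec (∃ λ p → IsPath G u v p × P p)
∃path? {n} G u v {P} P? =
  map′ (λ (_ , _ , w , q) → toList w , q)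
       (λ (p , π , q) → length p , s≤s (unique⇒length≤ (IsPath.distinct π)) , fromList p ,
          subst (λ p → IsPath G u v p × P p) (sym (toList∘fromList p)) (π , q))
       (ℕ.anyUpTo? (λ m → ∃? (∈-vecs ∈-allFin) {λ (w : Vec (Fin n) m) → IsPath G u v (toList w) × P (toList w)}
                    λ w → isPath? G u v (toList w) ×-dec P? (toList w))
                   (suc n))

connected? : ∀ {n} → Decidable (Connected {n})
connected? G = Fin.all? λ u → Fin.all? λ v →
  map′ (λ (p , π , _) → p , π) (λ (p , π) → p , π , refl)
       (∃path? G u v {λ p → p ≡ p} (λ _ → yes refl))

properlyConnecting? : ∀ {n k} {G : Graph n} → Decidable (ProperlyConnecting {k = k} {G})
properlyConnecting? {G = G} c = Fin.all? λ u → Fin.all? λ v →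
  ¬? (u Fin.≟ v) →-dec
  ∃path? G u v (λ p → linked? (λ a b → ¬? (a Fin.≟ b)) (edgeColours (colour c) p))

edgeColours-cong : ∀ {n} {C : Set} {c d : Fin n → Fin n → C} →
                   (∀ u v → c u v ≡ d u v) → ∀ p → edgeColours c p ≡ edgeColours d p
edgeColours-cong eq []          = refl
edgeColours-cong eq (x ∷ [])    = refl
edgeColours-cong eq (x ∷ y ∷ p) = cong₂ _∷_ (eq x y) (edgeColours-cong eq (y ∷ p))

private
  module _ {n : ℕ} (G : Graph n) (k : ℕ) where

    Table : Set
    Table = Vec (Vec (Fin k) n) n

    entry : Table → Fin n → Fin n → Fin k
    entry T u v = Vec.lookup (Vec.lookup T u) v

    Good : Table → Set
    Good T = Σ (∀ u v → Adj G u v → entry T u v ≡ entry T v u) λ s →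
      ProperlyConnecting {G = G} (record { colour = entry T ; colour-sym = s })

    good? : Decidable Good
    good? T with Fin.all? (λ u → Fin.all? (λ v →
                   adj? G u v →-dec (entry T u v Fin.≟ entry T v u)))
    ... | no ¬s = no (¬s ∘ proj₁)
    ... | yes s = map′ (s ,_) proj₂
      (properlyConnecting? {G = G} (record { colour = entry T ; colour-sym = s }))

    tabled : ProperlyConnectable k G → ∃ Good
    tabled (c , pc) = T , s , λ u v u≢v →
      let p , π , q = pc u v u≢v
      in  p , π , subst (Linked _≢_) (edgeColours-cong (λ x y → sym (eq x y)) p) q
      where
      T : Table
      T = tabulate λ u → tabulate (colour c u)

      eq : ∀ u v → entry T u v ≡ colour c u v
      eq u v = trans (cong (λ row → Vec.lookup row v) (lookup∘tabulate _ u))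
                     (lookup∘tabulate (colour c u) v)

      s : ∀ u v → Adj G u v → entry T u v ≡ entry T v u
      s u v a = trans (eq u v) (trans (colour-sym c u v a) (sym (eq v u)))

properlyConnectable? : ∀ {n} k → Decidable (ProperlyConnectable {n} k)
properlyConnectable? k G =
  map′ (λ (T , s , pc) → record { colour = entry G k T ; colour-sym = s } , pc)
       (tabled G k)
       (∃? (∈-vecs (∈-vecs ∈-allFin)) (good? G k))

properConnectionNumber? : ∀ {n} k → Decidable (ProperConnectionNumber {n} k)
properConnectionNumber? k G =
  properlyConnectable? k G ×-dec
  ℕ.allUpTo? (λ j → ¬? (properlyConnectable? j G)) k

#graphs : ∀ n {P : Pred (Graph n) 0ℓ} → Decidable P → ℕ
#graphs n P? = length (filter P? (graphs n))

#regular : ℕ → ℕ → ℕ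
#regular r n = #graphs n (regular? r)

#regular-pc2 : ℕ → ℕ → ℕ
#regular-pc2 r n =
  #graphs n (λ G → regular? r G ×-dec connected? G ×-dec properConnectionNumber? 2 G)

{-# OPTIONS --safe #-}
module Submission where

-- A graph all of whose cuts have at least three edges has pc ≤ 2: the edges across a maximum cut X
-- form a spanning subgraph that meets every cut in at least two edges, hence has a strongly
-- connected orientation, and colouring every arc by the side of X on which its tail lies makes the
-- directed paths alternate.  So only the r-regular graphs having a cut (S , V ∖ S) of at most two
-- edges are to be counted; there s = |S| may be assumed to lie between 4 and n / 2.
-- Replacing edges ab inside S and cd outside S by ac and bd adds 2 to the size of the cut.
-- Counting these switchings both ways gives, for the numbers A_j of r-regular graphs whose cut at S
-- has j edges, A_j F_j ≤ A_{j+2} (j + 2)², with F_j of the order of (rs − j)(r(n − s) − j).  For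
-- j = j₀ + 2k, j₀ ≤ 2, one has F_j ≥ 4(p − k)(q − k) with p = s + ⌊s / 4⌋, p + q + 2 = n + 30M and
-- M = ⌊n / 160⌋, so that C(p + 1, k + 1) C(q + 1, k + 1) A_{j₀} ≤ (p + 1)(q + 1) A_{j₀+2k}.  Summing
-- over k by Vandermonde's identity bounds A_{j₀} by a polynomial multiple of 1 / C(n + 30M, p + 1),
-- which is much smaller than 1 / C(n, s), and the union bound over all S is O(1 / n).

open import Defs
open import Data.Bool.Base using (Bool; true; false; not; _∧_; _xor_; if_then_else_)
import Data.Bool.Properties as Bool
open import Data.Empty using (⊥; ⊥-elim)
open import Data.Fin.Base using (Fin; zero; suc)
import Data.Fin.Properties as Fin
open import Data.Fin.Subset as Subset using (Subset; _∈_; _∉_; _∩_; _∪_; ∁; ⁅_⁆; _⊃_)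
open import Data.Fin.Subset.Induction using (⊃-wellFounded; Acc; acc)
open import Data.Fin.Subset.Properties using (_∈?_; anySubset?; x∈p∩q⁺; x∈p∩q⁻; x∈p∪q⁻; x∈⁅x⁆; x∈⁅y⁆⇒x≡y; p⊆p∪q; q⊆p∪q; ∣∁p∣≡n∸∣p∣; x∉p⇒x∈∁p)
open import Data.List.Base using (List; []; _∷_; length; map; filter; head; last; _++_; allFin; cartesianProduct; downFrom)
open import Data.List.Membership.DecPropositional using () renaming (_∈?_ to member?)
import Data.List.Membership.Propositional as List
open import Data.List.Membership.Propositional.Properties using (∈-allFin; ∈-cartesianProduct⁺; ∈-downFrom⁺)
open import Data.List.Properties using (map-tabulate; length-tabulate; length-downFrom)
open import Data.List.Relation.Unary.All as All using (All; []; _∷_)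
open import Data.List.Relation.Unary.All.Properties using (¬Any⇒All¬)
open import Data.List.Relation.Unary.AllPairs using ([]; _∷_)
open import Data.List.Relation.Unary.Any using (here; there)
open import Data.List.Relation.Unary.Linked using (Linked; []; [-]; _∷_)
open import Data.List.Relation.Unary.Unique.Propositional using (Unique)
open import Data.Maybe.Base using (just)
open import Data.Nat.Base hiding (_<_; _/_; _%_; ∣_-_∣)
open import Data.Nat.Combinatorics using (_C_; nCk≡nC[n∸k]; nCn≡1; nC1≡n; nCk+nC[k+1]≡[n+1]C[k+1])
import Data.Nat.DivMod as ℕ/
open import Data.Nat.Properties
open import Algebra.Properties.CommutativeSemigroup +-commutativeSemigroup using (interchange)
open import Data.Nat.Solver using (module +-*-Solver)
open import Data.List.Extrema ≤-totalOrder using (argmax; f[xs]≤f[argmax])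
open import Data.Product.Base using (∃; _×_; _,_; proj₁; proj₂)
open import Data.Sum.Base using (_⊎_; inj₁; inj₂)
open import Data.Vec.Base as Vec using (Vec; []; _∷_)
open import Data.Vec.Properties as Vec using (lookup∘tabulate; lookup-map; lookup-zipWith; lookup⇒[]=; []=⇒lookup; ≡-dec)
open import Function.Base using (_∘_; id; case_of_)
open import Level using (0ℓ)
open import Relation.Binary.Construct.Closure.ReflexiveTransitive using (Star; _◅_; _◅◅_) renaming (ε to stay)
open import Relation.Binary.PropositionalEquality
open import Relation.Nullary using (¬_; Dec; yes; no; does; contradiction; ¬?; _×-dec_)
open import Relation.Nullary.Decidable using (map′)
open import Relation.Unary using (Pred; Decidable)
open +-*-Solver using (solve; con; _:+_; _:*_; _:=_)

-- The obstacle is the switchings blocked by an existing edge: their number involves `r²`, while the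
-- main term is estimated through `r ≥ 3` alone. Without them `p` could be near `3s / 2`. Taking `p`
-- near `5s / 4` leaves a slack proportional to `s` in the factor for `S` and, for large `n`, a
-- slack of `10r²` in the factor for the complement; the cross terms of the product pay for the
-- blocked switchings.
--
-- The gain over the number of sets `S` is the factor `C(30M, t)` with `t = p + 1 − s`. It has to
-- beat the factor `(p + 2)(p + 1)(q + 1)`, of order `M³`, and the number of sizes `s`, of order
-- `M`, and still leave `1 / M`: this asks for `M⁵`, hence for `t ≥ 5`. For `s < 16` only `t ≥ 2`
-- and `M²` are available, but then `p` is bounded, the factor is linear in `M`, and there are
-- boundedly many sizes.
--
-- Cuts of two edges have to be excluded, and not only bridges, since a maximum cut keeps at least
-- half of the edges of every cut, and two of them are required.

∑ : {A : Set} → List A → (A → ℕ) → ℕ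
∑ []       f = 0
∑ (x ∷ xs) f = f x + ∑ xs f

syntax ∑ xs (λ x → e) = ∑[ x ∈ xs ] e

infixr 6.5 ∑

-- Laws of finite sums, and double counting

module _ {A : Set} where

  ∑-cong : ∀ xs {f g : A → ℕ} → (∀ x → f x ≡ g x) → ∑ xs f ≡ ∑ xs g
  ∑-cong []       eq = refl
  ∑-cong (x ∷ xs) eq = cong₂ _+_ (eq x) (∑-cong xs eq)

  ∑-mono : ∀ xs {f g : A → ℕ} → (∀ x → f x ≤ g x) → ∑ xs f ≤ ∑ xs g
  ∑-mono []       le = z≤n
  ∑-mono (x ∷ xs) le = +-mono-≤ (le x) (∑-mono xs le)

  ∑-zero : ∀ (xs : List A) → ∑ xs (λ _ → 0) ≡ 0
  ∑-zero []       = refl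
  ∑-zero (x ∷ xs) = ∑-zero xs

  ∑-+ : ∀ xs (f g : A → ℕ) → ∑ xs (λ x → f x + g x) ≡ ∑ xs f + ∑ xs g
  ∑-+ []       f g = refl
  ∑-+ (x ∷ xs) f g = trans (cong (f x + g x +_) (∑-+ xs f g)) (interchange (f x) (g x) _ _)

  ∑-*ˡ : ∀ xs c (f : A → ℕ) → ∑ xs (λ x → c * f x) ≡ c * ∑ xs f
  ∑-*ˡ []       c f = sym (*-zeroʳ c)
  ∑-*ˡ (x ∷ xs) c f = trans (cong (c * f x +_) (∑-*ˡ xs c f)) (sym (*-distribˡ-+ c _ _))

  ∑-*ʳ : ∀ xs (f : A → ℕ) c → ∑ xs (λ x → f x * c) ≡ ∑ xs f * c
  ∑-*ʳ xs f c = trans (∑-cong xs λ x → *-comm (f x) c) (trans (∑-*ˡ xs c f) (*-comm c _))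

  ∑-const : ∀ (xs : List A) c → ∑ xs (λ _ → c) ≡ length xs * c
  ∑-const []       c = refl
  ∑-const (x ∷ xs) c = cong (c +_) (∑-const xs c)

∑-swap : ∀ {A B : Set} (xs : List A) (ys : List B) (f : A → B → ℕ) →
         ∑[ x ∈ xs ] ∑[ y ∈ ys ] f x y ≡ ∑[ y ∈ ys ] ∑[ x ∈ xs ] f x y
∑-swap []       ys f = sym (∑-zero ys)
∑-swap (x ∷ xs) ys f =
  trans (cong (∑ ys (f x) +_) (∑-swap xs ys f)) (sym (∑-+ ys (f x) (λ y → ∑ xs (λ x → f x y))))

module _ {A : Set} where

  term≤∑ : ∀ {xs} {x : A} (f : A → ℕ) → x List.∈ xs → f x ≤ ∑ xs f
  term≤∑ f (here refl) = m≤m+n _ _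
  term≤∑ f (there i)   = ≤-trans (term≤∑ f i) (m≤n+m _ _)

  ∑-map : ∀ {B : Set} (h : B → A) xs (f : A → ℕ) → ∑ (map h xs) f ≡ ∑ xs (f ∘ h)
  ∑-map h []       f = refl
  ∑-map h (x ∷ xs) f = cong (f (h x) +_) (∑-map h xs f)

  ∑-++ : ∀ xs ys (f : A → ℕ) → ∑ (xs ++ ys) f ≡ ∑ xs f + ∑ ys f
  ∑-++ []       ys f = refl
  ∑-++ (x ∷ xs) ys f = trans (cong (f x +_) (∑-++ xs ys f)) (sym (+-assoc (f x) _ _))

∑-*-∑ : ∀ {A B : Set} xs ys (f : A → ℕ) (g : B → ℕ) →
        ∑[ x ∈ xs ] ∑[ y ∈ ys ] (f x * g y) ≡ ∑ xs f * ∑ ys g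
∑-*-∑ xs ys f g = trans (∑-cong xs λ x → ∑-*ˡ ys (f x) g) (∑-*ʳ xs f (∑ ys g))

𝟙 : Bool → ℕ
𝟙 true  = 1
𝟙 false = 0

𝟙≤1 : ∀ b → 𝟙 b ≤ 1
𝟙≤1 true  = ≤-refl
𝟙≤1 false = z≤n

⟦_⟧ : ∀ {p} {P : Set p} → Dec P → ℕ
⟦ P? ⟧ = 𝟙 (does P?)

module _ {p} {P : Set p} where

  ⟦⟧-yes : (P? : Dec P) → P → ⟦ P? ⟧ ≡ 1
  ⟦⟧-yes (yes _) _ = refl
  ⟦⟧-yes (no ¬p) p = contradiction p ¬p

  ⟦⟧-no : (P? : Dec P) → ¬ P → ⟦ P? ⟧ ≡ 0
  ⟦⟧-no (yes p) ¬p = contradiction p ¬p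
  ⟦⟧-no (no _)  _  = refl

  ⟦⟧-intro : ∀ (P? : Dec P) {m} → (P → 1 ≤ m) → ⟦ P? ⟧ ≤ m
  ⟦⟧-intro (yes p) le = le p
  ⟦⟧-intro (no _)  _  = z≤n

module _ {A : Set} {P : Pred A 0ℓ} (P? : Decidable P) where

  length-filter≡∑ : ∀ xs → length (filter P? xs) ≡ ∑[ x ∈ xs ] ⟦ P? x ⟧
  length-filter≡∑ [] = refl
  length-filter≡∑ (x ∷ xs) with P? x
  ... | yes _ = cong suc (length-filter≡∑ xs)
  ... | no  _ = length-filter≡∑ xs

∑-unique≤ : ∀ {A : Set} {P : Pred A 0ℓ} (P? : Decidable P) {xs : List A} → Unique xs →
            (∀ {x y} → P x → P y → x ≡ y) → ∑[ x ∈ xs ] ⟦ P? x ⟧ ≤ 1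
∑-unique≤ P? [] inj = z≤n
∑-unique≤ P? {x ∷ xs} (x∉ ∷ xs!) inj with P? x
... | no _  = ∑-unique≤ P? xs! inj
... | yes p = s≤s (≤-reflexive (none x∉))
  where
  none : ∀ {ys} → All (x ≢_) ys → ∑[ y ∈ ys ] ⟦ P? y ⟧ ≡ 0
  none []        = refl
  none {y ∷ _} (n ∷ ns) = cong₂ _+_ (⟦⟧-no (P? y) (n ∘ inj p)) (none ns)

-- Transport of a count along an injection: by double counting of the pairs (x , f x).
∑-injection : ∀ {A B : Set} {xs : List A} {ys : List B} → Unique xs → (∀ y → y List.∈ ys) →
              (f : A → B) → (∀ {x x′} → f x ≡ f x′ → x ≡ x′) → (∀ y y′ → Dec (y ≡ y′)) →
              (w : B → ℕ) → ∑ xs (w ∘ f) ≤ ∑ ys w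
∑-injection {xs = xs} {ys} xs! all f inj _≟_ w = begin
  ∑[ x ∈ xs ] w (f x)
    ≤⟨ ∑-mono xs (λ x → ≤-trans (≤-reflexive (sym (trans (cong (_* w (f x)) (⟦⟧-yes (f x ≟ f x) refl)) (*-identityˡ _))))
                                (term≤∑ (λ y → ⟦ f x ≟ y ⟧ * w y) (all (f x)))) ⟩
  ∑[ x ∈ xs ] ∑[ y ∈ ys ] (⟦ f x ≟ y ⟧ * w y)
    ≡⟨ ∑-swap xs ys _ ⟩
  ∑[ y ∈ ys ] ∑[ x ∈ xs ] (⟦ f x ≟ y ⟧ * w y)
    ≡⟨ ∑-cong ys (λ y → ∑-*ʳ xs _ (w y)) ⟩
  ∑[ y ∈ ys ] (∑[ x ∈ xs ] ⟦ f x ≟ y ⟧) * w y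
    ≤⟨ ∑-mono ys (λ y → *-monoˡ-≤ (w y) (∑-unique≤ (λ x → f x ≟ y) xs! λ p q → inj (trans p (sym q)))) ⟩
  ∑[ y ∈ ys ] 1 * w y
    ≡⟨ ∑-cong ys (λ y → *-identityˡ (w y)) ⟩
  ∑ ys w ∎
  where open ≤-Reasoning

∑-allFin-suc : ∀ n (f : Fin (suc n) → ℕ) → ∑ (allFin (suc n)) f ≡ f zero + ∑ (allFin n) (f ∘ suc)
∑-allFin-suc n f = cong (f zero +_)
  (trans (cong (λ xs → ∑ xs f) (sym (map-tabulate id suc))) (∑-map suc (allFin n) f))

∑ᶠ : ∀ {n} → (Fin n → ℕ) → ℕ
∑ᶠ {n} = ∑ (allFin n)

δ : ∀ {n} → Fin n → Fin n → ℕ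
δ u v = ⟦ u Fin.≟ v ⟧

∑-δ : ∀ {n} (f : Fin n → ℕ) (x : Fin n) → ∑[ u ∈ allFin n ] (δ u x * f u) ≡ f x
∑-δ {suc n} f zero = trans (∑-allFin-suc n _) (trans (cong₂ _+_ (+-identityʳ (f zero)) (∑-zero (allFin n))) (+-identityʳ _))
∑-δ {suc n} f (suc x) = trans (∑-allFin-suc n (λ u → δ u (suc x) * f u)) (∑-δ (f ∘ suc) x)

-- Indicators, Boolean adjacency, and toggling one edge

χ χ̄ : ∀ {n} → Subset n → Fin n → ℕ
χ S u = 𝟙 (Vec.lookup S u)
χ̄ S u = 𝟙 (not (Vec.lookup S u))

adj : ∀ {n} → Graph n → Fin n → Fin n → Bool
adj G u v = Vec.lookup (Vec.lookup (neighbours G) u) v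

Adj⇒adj : ∀ {n} (G : Graph n) {u v} → Adj G u v → adj G u v ≡ true
Adj⇒adj G = []=⇒lookup

adj⇒Adj : ∀ {n} (G : Graph n) {u v} → adj G u v ≡ true → Adj G u v
adj⇒Adj G = lookup⇒[]= _ _

adj-comm : ∀ {n} (G : Graph n) u v → adj G u v ≡ adj G v u
adj-comm G u v with adj G u v in p | adj G v u in q
... | true  | true  = refl
... | false | false = refl
... | true  | false = trans (sym (Adj⇒adj G (adj-sym G u v (adj⇒Adj G p)))) q
... | false | true  = trans (sym p) (Adj⇒adj G (adj-sym G v u (adj⇒Adj G q)))

adj-diag : ∀ {n} (G : Graph n) u → adj G u u ≡ false
adj-diag G u with adj G u u in p
... | true  = contradiction (adj⇒Adj G p) (adj-irrefl G u)
... | false = refl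

table : ∀ {n} → (Fin n → Fin n → Bool) → Vec (Subset n) n
table f = Vec.tabulate (λ u → Vec.tabulate (f u))

lookup-table : ∀ {n} (f : Fin n → Fin n → Bool) u v → Vec.lookup (Vec.lookup (table f) u) v ≡ f u v
lookup-table f u v = trans (cong (λ S → Vec.lookup S v) (lookup∘tabulate (λ u → Vec.tabulate (f u)) u))
                           (lookup∘tabulate (f u) v)

graph : ∀ {n} (f : Fin n → Fin n → Bool) →
        .(∀ u v → f u v ≡ f v u) → .(∀ u → f u u ≡ false) → Graph n
graph f f-sym f-irrefl = mkGraph (table f)
  (λ u v v∈ → lookup⇒[]= _ _ (trans (lookup-table f v u)
    (trans (f-sym v u) (trans (sym (lookup-table f u v)) ([]=⇒lookup v∈)))))
  (λ u u∈ → case trans (sym ([]=⇒lookup u∈)) (trans (lookup-table f u u) (f-irrefl u)) of λ ())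

vec-ext : ∀ {A : Set} {n} {xs ys : Vec A n} → (∀ i → Vec.lookup xs i ≡ Vec.lookup ys i) → xs ≡ ys
vec-ext {xs = xs} {ys} eq =
  trans (sym (Vec.tabulate∘lookup xs)) (trans (Vec.tabulate-cong eq) (Vec.tabulate∘lookup ys))

neighbours-injective : ∀ {n} {G H : Graph n} → neighbours G ≡ neighbours H → G ≡ H
neighbours-injective refl = refl

graph-ext : ∀ {n} {G H : Graph n} → (∀ u v → adj G u v ≡ adj H u v) → G ≡ H
graph-ext eq = neighbours-injective (vec-ext λ u → vec-ext (eq u))

_≟ᴳ_ : ∀ {n} (G H : Graph n) → Dec (G ≡ H)
G ≟ᴳ H = map′ neighbours-injective (cong neighbours) (≡-dec (≡-dec Bool._≟_) (neighbours G) (neighbours H))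

δᵇ : ∀ {n} → Fin n → Fin n → Bool
δᵇ u v = does (u Fin.≟ v)

-- With xor instead of or, x = y gives the empty set of pairs.
pair : ∀ {n} → Fin n → Fin n → Fin n → Fin n → Bool
pair x y u v = (δᵇ u x ∧ δᵇ v y) xor (δᵇ u y ∧ δᵇ v x)

-- Flipping the edge instead of adding or deleting it makes the operation total and injective for
-- all `x` and `y`. A switching, being a composite of four flips, is then an injection on all
-- graphs, as `∑-injection` demands.
toggle : ∀ {n} → Fin n → Fin n → Graph n → Graph n
toggle x y G = graph (λ u v → adj G u v xor pair x y u v)
  (λ u v → cong₂ _xor_ (adj-comm G u v)
    (trans (Bool.xor-comm (δᵇ u x ∧ δᵇ v y) _)
           (cong₂ _xor_ (Bool.∧-comm (δᵇ u y) _) (Bool.∧-comm (δᵇ u x) _))))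
  (λ u → cong₂ _xor_ (adj-diag G u)
    (trans (cong (_xor (δᵇ u y ∧ δᵇ u x)) (Bool.∧-comm (δᵇ u x) _)) (Bool.xor-same (δᵇ u y ∧ δᵇ u x))))

adj-toggle : ∀ {n} (x y : Fin n) G u v → adj (toggle x y G) u v ≡ adj G u v xor pair x y u v
adj-toggle x y G = lookup-table λ u v → adj G u v xor pair x y u v

toggle-injective : ∀ {n} (x y : Fin n) {G H} → toggle x y G ≡ toggle x y H → G ≡ H
toggle-injective x y {G} {H} eq = graph-ext λ u v →
  xor-cancelʳ (pair x y u v)
    (trans (sym (adj-toggle x y G u v)) (trans (cong (λ K → adj K u v) eq) (adj-toggle x y H u v)))
  where
  xor-cancelʳ : ∀ c {a b} → a xor c ≡ b xor c → a ≡ b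
  xor-cancelʳ c {a} {b} eq = trans (sym (undo a)) (trans (cong (_xor c) eq) (undo b))
    where
    undo : ∀ a → (a xor c) xor c ≡ a
    undo a = trans (Bool.xor-assoc a c c) (trans (cong (a xor_) (Bool.xor-same c)) (Bool.xor-identityʳ a))

does-true : ∀ {P : Set} (P? : Dec P) → does P? ≡ true → P
does-true (yes p) _ = p

pair-true : ∀ {n} (x y u v : Fin n) → pair x y u v ≡ true → (u ≡ x × v ≡ y) ⊎ (u ≡ y × v ≡ x)
pair-true x y u v eq with xor-true (δᵇ u x) (δᵇ v y) (δᵇ u y) (δᵇ v x) eq
  where
  xor-true : ∀ a b c d → (a ∧ b) xor (c ∧ d) ≡ true → (a ≡ true × b ≡ true) ⊎ (c ≡ true × d ≡ true)
  xor-true true  true  c    d    _  = inj₁ (refl , refl)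
  xor-true true  false true true _  = inj₂ (refl , refl)
  xor-true false b     true true _  = inj₂ (refl , refl)
... | inj₁ (p , q) = inj₁ (does-true (u Fin.≟ x) p , does-true (v Fin.≟ y) q)
... | inj₂ (p , q) = inj₂ (does-true (u Fin.≟ y) p , does-true (v Fin.≟ x) q)

𝟙-pair : ∀ {n} {x y : Fin n} → x ≢ y → ∀ u v → 𝟙 (pair x y u v) ≡ δ u x * δ v y + δ u y * δ v x
𝟙-pair {x = x} {y} x≢y u v = go (δᵇ u x) (δᵇ v y) (δᵇ u y) (δᵇ v x)
  λ p q → x≢y (trans (sym (does-true (u Fin.≟ x) p)) (does-true (u Fin.≟ y) q))
  where
  go : ∀ a b c d → (a ≡ true → c ≡ true → ⊥) → 𝟙 ((a ∧ b) xor (c ∧ d)) ≡ 𝟙 a * 𝟙 b + 𝟙 c * 𝟙 d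
  go true  b     true  d     h = ⊥-elim (h refl refl)
  go true  true  false d     h = refl
  go true  false false d     h = refl
  go false b     true  true  h = refl
  go false b     true  false h = refl
  go false b     false d     h = refl

A : ∀ {n} → Graph n → Fin n → Fin n → ℕ
A G u v = 𝟙 (adj G u v)

-- Pairing of a weight on ordered pairs with the adjacency matrix. Degrees and cut sizes are both of
-- this form, so the effect of a switching is computed once for every `w`.
⟪_,_⟫ : ∀ {n} → (Fin n → Fin n → ℕ) → Graph n → ℕ
⟪ w , G ⟫ = ∑ᶠ λ u → ∑ᶠ λ v → w u v * A G u v

δδ : ∀ {n} → Fin n → Fin n → Fin n → Fin n → ℕ
δδ x y u v = δ u x * δ v y + δ u y * δ v x

module _ {n} (G : Graph n) {x y : Fin n} (x≢y : x ≢ y) where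

  private
    adj-pair : ∀ u v → pair x y u v ≡ true → adj G u v ≡ adj G x y
    adj-pair u v eq with pair-true x y u v eq
    ... | inj₁ (refl , refl) = refl
    ... | inj₂ (refl , refl) = adj-comm G y x

  A-toggle⁺ : adj G x y ≡ false → ∀ u v → A (toggle x y G) u v ≡ A G u v + δδ x y u v
  A-toggle⁺ xy u v = trans (cong 𝟙 (adj-toggle x y G u v))
    (trans (go (adj G u v) (pair x y u v) (λ p → trans (adj-pair u v p) xy))
           (cong (A G u v +_) (𝟙-pair x≢y u v)))
    where
    go : ∀ a p → (p ≡ true → a ≡ false) → 𝟙 (a xor p) ≡ 𝟙 a + 𝟙 p
    go true  true  h = case h refl of λ ()
    go true  false h = refl
    go false p     h = refl

  A-toggle⁻ : adj G x y ≡ true → ∀ u v → A (toggle x y G) u v + δδ x y u v ≡ A G u v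
  A-toggle⁻ xy u v = trans (cong₂ _+_ (cong 𝟙 (adj-toggle x y G u v)) (sym (𝟙-pair x≢y u v)))
    (go (adj G u v) (pair x y u v) (λ p → trans (adj-pair u v p) xy))
    where
    go : ∀ a p → (p ≡ true → a ≡ true) → 𝟙 (a xor p) + 𝟙 p ≡ 𝟙 a
    go false true  h = case h refl of λ ()
    go true  true  h = refl
    go true  false h = refl
    go false false h = refl

∑∑-δδ : ∀ {n} (w : Fin n → Fin n → ℕ) x y →
        ∑ᶠ (λ u → ∑ᶠ λ v → w u v * δδ x y u v) ≡ w x y + w y x
∑∑-δδ {n} w x y = begin
  ∑ᶠ (λ u → ∑ᶠ λ v → w u v * δδ x y u v)
    ≡⟨ ∑-cong (allFin n) (λ u → trans (∑-cong (allFin n) (λ v → expand (w u v) (δ u x) (δ v y) (δ u y) (δ v x)))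
         (trans (∑-+ (allFin n) _ _) (cong₂ _+_ (inner u x y) (inner u y x)))) ⟩
  ∑ᶠ (λ u → δ u x * w u y + δ u y * w u x)
    ≡⟨ trans (∑-+ (allFin n) _ _) (cong₂ _+_ (∑-δ (λ u → w u y) x) (∑-δ (λ u → w u x) y)) ⟩
  w x y + w y x ∎
  where
  open ≡-Reasoning
  expand : ∀ w a b c d → w * (a * b + c * d) ≡ a * (b * w) + c * (d * w)
  expand = solve 5 (λ w a b c d → w :* (a :* b :+ c :* d) := a :* (b :* w) :+ c :* (d :* w)) refl
  inner : ∀ u x y → ∑ᶠ (λ v → δ u x * (δ v y * w u v)) ≡ δ u x * w u y
  inner u x y = trans (∑-*ˡ (allFin n) (δ u x) _) (cong (δ u x *_) (∑-δ (w u) y))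

∑∑-w-+ : ∀ {n} (w f g : Fin n → Fin n → ℕ) →
         ∑ᶠ (λ u → ∑ᶠ λ v → w u v * (f u v + g u v)) ≡
         ∑ᶠ (λ u → ∑ᶠ λ v → w u v * f u v) + ∑ᶠ (λ u → ∑ᶠ λ v → w u v * g u v)
∑∑-w-+ {n} w f g = trans
  (∑-cong (allFin n) λ u → trans (∑-cong (allFin n) λ v → *-distribˡ-+ (w u v) _ _) (∑-+ (allFin n) _ _)) (∑-+ (allFin n) _ _)

module _ {n} (G : Graph n) {x y : Fin n} (x≢y : x ≢ y) (w : Fin n → Fin n → ℕ) where

  ⟪⟫-toggle⁺ : adj G x y ≡ false → ⟪ w , toggle x y G ⟫ ≡ ⟪ w , G ⟫ + (w x y + w y x)
  ⟪⟫-toggle⁺ xy = trans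
    (∑-cong (allFin n) λ u → ∑-cong (allFin n) λ v → cong (w u v *_) (A-toggle⁺ G x≢y xy u v))
    (trans (∑∑-w-+ w (A G) (δδ x y)) (cong (⟪ w , G ⟫ +_) (∑∑-δδ w x y)))

  ⟪⟫-toggle⁻ : adj G x y ≡ true → ⟪ w , toggle x y G ⟫ + (w x y + w y x) ≡ ⟪ w , G ⟫
  ⟪⟫-toggle⁻ xy = trans
    (cong (⟪ w , toggle x y G ⟫ +_) (sym (∑∑-δδ w x y)))
    (trans (sym (∑∑-w-+ w (A (toggle x y G)) (δδ x y)))
      (∑-cong (allFin n) λ u → ∑-cong (allFin n) λ v → cong (w u v *_) (A-toggle⁻ G x≢y xy u v)))

adj-toggle-off : ∀ {n} (x y : Fin n) G u v → ¬ (u ≡ x × v ≡ y) → ¬ (u ≡ y × v ≡ x) →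
                 adj (toggle x y G) u v ≡ adj G u v
adj-toggle-off x y G u v ¬p ¬q = trans (adj-toggle x y G u v)
  (trans (cong (adj G u v xor_) off) (Bool.xor-identityʳ _))
  where
  off : pair x y u v ≡ false
  off with pair x y u v in eq
  ... | false = refl
  ... | true with pair-true x y u v eq
  ...   | inj₁ p = ⊥-elim (¬p p)
  ...   | inj₂ q = ⊥-elim (¬q q)

∣∣≡∑χ : ∀ {n} (S : Subset n) → Subset.∣ S ∣ ≡ ∑ᶠ (χ S)
∣∣≡∑χ []          = refl
∣∣≡∑χ {suc n} (true  ∷ S) = trans (cong suc (∣∣≡∑χ S)) (sym (∑-allFin-suc n (χ (true ∷ S))))
∣∣≡∑χ {suc n} (false ∷ S) = trans (∣∣≡∑χ S) (sym (∑-allFin-suc n (χ (false ∷ S))))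

deg : ∀ {n} → Graph n → Fin n → ℕ
deg G u = ∑ᶠ (A G u)

Regular⇒deg : ∀ {n r} (G : Graph n) → Regular r G → ∀ u → deg G u ≡ r
Regular⇒deg G reg u = trans (sym (∣∣≡∑χ (N G u))) (reg u)

deg⇒Regular : ∀ {n r} (G : Graph n) → (∀ u → deg G u ≡ r) → Regular r G
deg⇒Regular G reg u = trans (∣∣≡∑χ (N G u)) (reg u)

deg≡⟪⟫ : ∀ {n} (G : Graph n) x → ⟪ (λ u _ → δ u x) , G ⟫ ≡ deg G x
deg≡⟪⟫ {n} G x = trans (∑-cong (allFin n) λ u → ∑-*ˡ (allFin n) (δ u x) (A G u)) (∑-δ (deg G) x)

-- Cuts and switchings

boundary : ∀ {n} → Subset n → Fin n → Fin n → ℕ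
boundary S u v = χ S u * χ̄ S v

cut : ∀ {n} → Subset n → Graph n → ℕ
cut S G = ⟪ boundary S , G ⟫

switch : ∀ {n} (a b c d : Fin n) → Graph n → Graph n
switch a b c d G = toggle b d (toggle a c (toggle c d (toggle a b G)))

switch-injective : ∀ {n} (a b c d : Fin n) {G H} → switch a b c d G ≡ switch a b c d H → G ≡ H
switch-injective a b c d eq =
  toggle-injective a b (toggle-injective c d (toggle-injective a c (toggle-injective b d eq)))

private
  adj-toggled : ∀ {n} (G : Graph n) {x y} → x ≢ y → adj G x y ≡ false → adj (toggle x y G) x y ≡ true
  adj-toggled G {x} {y} x≢y xy = trans (adj-toggle x y G x y) (trans (cong (_xor pair x y x y) xy)
    (𝟙-pos (≤-trans (≤-reflexive (sym (cong₂ _*_ (⟦⟧-yes (x Fin.≟ x) refl) (⟦⟧-yes (y Fin.≟ y) refl))))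
      (≤-trans (m≤m+n (δ x x * δ y y) (δ x y * δ y x)) (≤-reflexive (sym (𝟙-pair x≢y x y)))))))
    where
    𝟙-pos : ∀ {b} → 1 ≤ 𝟙 b → b ≡ true
    𝟙-pos {true} _ = refl

-- The four vertices are distinct: two lie in `S` and two outside, and `ab` and `cd` are edges. So
-- the four toggles concern four different pairs, and each pair keeps its original status until its
-- turn.
module Switch {n} (S : Subset n) (G : Graph n) {a b c d : Fin n}
  (a∈ : Vec.lookup S a ≡ true) (b∈ : Vec.lookup S b ≡ true)
  (c∉ : Vec.lookup S c ≡ false) (d∉ : Vec.lookup S d ≡ false)
  (ab : adj G a b ≡ true) (cd : adj G c d ≡ true)
  (ac : adj G a c ≡ false) (bd : adj G b d ≡ false) where

  private
    apart : ∀ {x y} → Vec.lookup S x ≡ true → Vec.lookup S y ≡ false → x ≢ y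
    apart x∈ x∉ refl = case trans (sym x∈) x∉ of λ ()

    edge : ∀ {x y} → adj G x y ≡ true → x ≢ y
    edge {x} xy refl = case trans (sym xy) (adj-diag G x) of λ ()

    G₁ G₂ G₃ G₄ : Graph n
    G₁ = toggle a b G
    G₂ = toggle c d G₁
    G₃ = toggle a c G₂
    G₄ = toggle b d G₃

    a≢b = edge ab
    c≢d = edge cd
    a≢c = apart a∈ c∉
    a≢d = apart a∈ d∉
    b≢c = apart b∈ c∉
    b≢d = apart b∈ d∉

    cd₁ : adj G₁ c d ≡ true
    cd₁ = trans (adj-toggle-off a b G c d (≢-sym a≢c ∘ proj₁) (≢-sym b≢c ∘ proj₁)) cd

    ac₂ : adj G₂ a c ≡ false
    ac₂ = trans (adj-toggle-off c d G₁ a c (a≢c ∘ proj₁) (a≢d ∘ proj₁))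
      (trans (adj-toggle-off a b G a c (≢-sym b≢c ∘ proj₂) (a≢b ∘ proj₁)) ac)

    bd₃ : adj G₃ b d ≡ false
    bd₃ = trans (adj-toggle-off a c G₂ b d (≢-sym a≢b ∘ proj₁) (b≢c ∘ proj₁))
      (trans (adj-toggle-off c d G₁ b d (b≢c ∘ proj₁) (b≢d ∘ proj₁))
      (trans (adj-toggle-off a b G b d (≢-sym a≢b ∘ proj₁) (≢-sym a≢d ∘ proj₂)) bd))

  switched-ac : adj (switch a b c d G) a c ≡ true
  switched-ac = trans (adj-toggle-off b d G₃ a c (a≢b ∘ proj₁) (a≢d ∘ proj₁))
                      (adj-toggled G₂ a≢c ac₂)

  switched-bd : adj (switch a b c d G) b d ≡ true
  switched-bd = adj-toggled G₃ b≢d bd₃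

  ⟪⟫-switch : ∀ w → ⟪ w , switch a b c d G ⟫ + (w c d + w d c) + (w a b + w b a) ≡
                    ⟪ w , G ⟫ + (w a c + w c a) + (w b d + w d b)
  ⟪⟫-switch w = begin
    ⟪ w , G₄ ⟫ + wcd + wab                 ≡⟨ cong (λ z → z + wcd + wab) (⟪⟫-toggle⁺ G₃ b≢d w bd₃) ⟩
    ⟪ w , G₃ ⟫ + wbd + wcd + wab           ≡⟨ cong (λ z → z + wbd + wcd + wab) (⟪⟫-toggle⁺ G₂ a≢c w ac₂) ⟩
    ⟪ w , G₂ ⟫ + wac + wbd + wcd + wab     ≡⟨ shuffle ⟪ w , G₂ ⟫ wac wbd wcd wab ⟩
    ⟪ w , G₂ ⟫ + wcd + wab + wac + wbd     ≡⟨ cong (λ z → z + wab + wac + wbd) (⟪⟫-toggle⁻ G₁ c≢d w cd₁) ⟩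
    ⟪ w , G₁ ⟫ + wab + wac + wbd           ≡⟨ cong (λ z → z + wac + wbd) (⟪⟫-toggle⁻ G a≢b w ab) ⟩
    ⟪ w , G ⟫ + wac + wbd ∎
    where
    open ≡-Reasoning
    wab = w a b + w b a
    wcd = w c d + w d c
    wac = w a c + w c a
    wbd = w b d + w d b
    shuffle : ∀ g ac bd cd ab → g + ac + bd + cd + ab ≡ g + cd + ab + ac + bd
    shuffle = solve 5 (λ g ac bd cd ab → g :+ ac :+ bd :+ cd :+ ab := g :+ cd :+ ab :+ ac :+ bd) refl

  -- Each of `a`, `b`, `c`, `d` lies on one deleted and one added edge; the term added on both sides
  -- is the common contribution of these edges.
  switch-deg : ∀ x → deg (switch a b c d G) x ≡ deg G x
  switch-deg x = +-cancelʳ-≡ (δ a x + δ b x + (δ c x + δ d x)) _ _ (begin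
    deg (switch a b c d G) x + (δ a x + δ b x + (δ c x + δ d x))
      ≡⟨ cong (_+ _) (deg≡⟪⟫ (switch a b c d G) x) ⟨
    ⟪ w , switch a b c d G ⟫ + (δ a x + δ b x + (δ c x + δ d x))
      ≡⟨ left ⟪ w , switch a b c d G ⟫ (δ a x) (δ b x) (δ c x) (δ d x) ⟩
    ⟪ w , switch a b c d G ⟫ + (δ c x + δ d x) + (δ a x + δ b x)
      ≡⟨ ⟪⟫-switch w ⟩
    ⟪ w , G ⟫ + (δ a x + δ c x) + (δ b x + δ d x)
      ≡⟨ right ⟪ w , G ⟫ (δ a x) (δ b x) (δ c x) (δ d x) ⟩
    ⟪ w , G ⟫ + (δ a x + δ b x + (δ c x + δ d x))
      ≡⟨ cong (_+ _) (deg≡⟪⟫ G x) ⟩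
    deg G x + (δ a x + δ b x + (δ c x + δ d x)) ∎)
    where
    open ≡-Reasoning
    w : Fin n → Fin n → ℕ
    w u _ = δ u x
    left : ∀ g a b c d → g + (a + b + (c + d)) ≡ g + (c + d) + (a + b)
    left = solve 5 (λ g a b c d → g :+ (a :+ b :+ (c :+ d)) := g :+ (c :+ d) :+ (a :+ b)) refl
    right : ∀ g a b c d → g + (a + c) + (b + d) ≡ g + (a + b + (c + d))
    right = solve 5 (λ g a b c d → g :+ (a :+ c) :+ (b :+ d) := g :+ (a :+ b :+ (c :+ d))) refl

  switch-cut : cut S (switch a b c d G) ≡ 2 + cut S G
  switch-cut with ⟪⟫-switch (boundary S)
  -- The weights of `ab` and `cd` reduce to 0, those of `ac` and `bd` to 1.
  ... | eq rewrite a∈ | b∈ | c∉ | d∉ =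
    trans (sym (trans (+-identityʳ _) (+-identityʳ _))) (trans eq (trans (+-assoc (cut S G) 1 1) (+-comm (cut S G) 2)))

-- Counting switchings in two ways

∑-cartesianProduct : ∀ {A B : Set} (xs : List A) (ys : List B) f →
                     ∑ (cartesianProduct xs ys) f ≡ ∑[ x ∈ xs ] ∑[ y ∈ ys ] f (x , y)
∑-cartesianProduct []       ys f = refl
∑-cartesianProduct (x ∷ xs) ys f = trans (∑-++ (map (x ,_) ys) _ f)
  (cong₂ _+_ (∑-map (x ,_) ys f) (∑-cartesianProduct xs ys f))

Pair : ℕ → Set
Pair n = Fin n × Fin n

∑² : ∀ {n} → (Fin n → Fin n → ℕ) → ℕ
∑² f = ∑ᶠ λ a → ∑ᶠ λ b → f a b

Quad : ℕ → Set
Quad n = Pair n × Pair n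

pairs : ∀ n → List (Pair n)
pairs n = cartesianProduct (allFin n) (allFin n)

quads : ∀ n → List (Quad n)
quads n = cartesianProduct (pairs n) (pairs n)

∑-quads : ∀ {n} (f : Quad n → ℕ) →
          ∑ (quads n) f ≡ ∑² λ a b → ∑² λ c d → f ((a , b) , (c , d))
∑-quads {n} f = trans (∑-cartesianProduct (pairs n) (pairs n) f)
  (trans (∑-cartesianProduct (allFin n) (allFin n) _)
    (∑-cong (allFin n) λ a → ∑-cong (allFin n) λ b → ∑-cartesianProduct (allFin n) (allFin n) _))

module _ {n : ℕ} where

  ∑²-cong : {f g : Fin n → Fin n → ℕ} → (∀ a b → f a b ≡ g a b) → ∑² f ≡ ∑² g
  ∑²-cong eq = ∑-cong (allFin n) λ a → ∑-cong (allFin n) (eq a)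

  ∑²-mono : {f g : Fin n → Fin n → ℕ} → (∀ a b → f a b ≤ g a b) → ∑² f ≤ ∑² g
  ∑²-mono le = ∑-mono (allFin n) λ a → ∑-mono (allFin n) (le a)

  ∑²-+ : (f g : Fin n → Fin n → ℕ) → ∑² (λ a b → f a b + g a b) ≡ ∑² f + ∑² g
  ∑²-+ f g = trans (∑-cong (allFin n) λ a → ∑-+ (allFin n) (f a) (g a)) (∑-+ (allFin n) _ _)

  ∑²-*ˡ : ∀ c (f : Fin n → Fin n → ℕ) → ∑² (λ a b → c * f a b) ≡ c * ∑² f
  ∑²-*ˡ c f = trans (∑-cong (allFin n) λ a → ∑-*ˡ (allFin n) c (f a)) (∑-*ˡ (allFin n) c _)

  ∑²-*ʳ : ∀ (f : Fin n → Fin n → ℕ) c → ∑² (λ a b → f a b * c) ≡ ∑² f * c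
  ∑²-*ʳ f c = trans (∑²-cong λ a b → *-comm (f a b) c) (trans (∑²-*ˡ c f) (*-comm c _))

  ∑²-swap : (f : Fin n → Fin n → ℕ) → ∑² f ≡ ∑² λ a b → f b a
  ∑²-swap f = ∑-swap (allFin n) (allFin n) f

  ∑⁴-+ : (f g : Fin n → Fin n → Fin n → Fin n → ℕ) →
         ∑² (λ a b → ∑² λ c d → f a b c d + g a b c d) ≡
         ∑² (λ a b → ∑² (f a b)) + ∑² (λ a b → ∑² (g a b))
  ∑⁴-+ f g = trans (∑²-cong λ a b → ∑²-+ (f a b) (g a b)) (∑²-+ (λ a b → ∑² (f a b)) (λ a b → ∑² (g a b)))

  ∑⁴-swap : (f : Fin n → Fin n → Fin n → Fin n → ℕ) →
            ∑² (λ a b → ∑² (f a b)) ≡ ∑² (λ a b → ∑² λ c d → f b a d c)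
  ∑⁴-swap f = trans (∑²-swap (λ a b → ∑² (f a b))) (∑²-cong λ a b → ∑²-swap (f b a))

A-comm : ∀ {n} (G : Graph n) u v → A G u v ≡ A G v u
A-comm G u v = cong 𝟙 (adj-comm G u v)

χ+χ̄ : ∀ {n} (S : Subset n) u → χ S u + χ̄ S u ≡ 1
χ+χ̄ S u with Vec.lookup S u
... | true  = refl
... | false = refl

module _ {n} (r : ℕ) (S : Subset n) where

  class : ℕ → Graph n → ℕ
  class j G = ⟦ regular? r G ⟧ * ⟦ cut S G ≟ j ⟧

  #cut : ℕ → ℕ
  #cut j = ∑ (graphs n) (class j)

  private
    e o : Graph n → Fin n → Fin n → ℕ
    e G a b = χ S a * χ S b * A G a b
    o G c d = χ̄ S c * χ̄ S d * A G c d

    crossing : Graph n → Fin n → Fin n → ℕ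
    crossing G a c = boundary S a c * A G a c

    Ā : Graph n → Fin n → Fin n → ℕ
    Ā G u v = 𝟙 (not (adj G u v))

    -- `forward` tests whether `q` can be switched in `G`. `backward` tests only that `ac` and `bd`
    -- are crossing edges, which is necessary after a switching; an upper bound is all that is
    -- wanted there. Pairs are ordered in both counts.
    forward backward : Graph n → Quad n → ℕ
    forward  G ((a , b) , (c , d)) = e G a b * o G c d * (Ā G a c * Ā G b d)
    backward G ((a , b) , (c , d)) = crossing G a c * crossing G b d

    module _ (G : Graph n) (reg : Regular r G) where

      ∑-A : ∀ u → ∑ᶠ (A G u) ≡ r
      ∑-A = Regular⇒deg G reg

      degree-sum : ∀ (f : Fin n → ℕ) → ∑² (λ u v → f u * A G u v) ≡ r * ∑ᶠ f
      degree-sum f = trans (∑-cong (allFin n) λ u →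
          trans (∑-*ˡ (allFin n) (f u) (A G u)) (trans (cong (f u *_) (∑-A u)) (*-comm (f u) r)))
        (∑-*ˡ (allFin n) r f)

      inner-edges : ∑² (e G) + cut S G ≡ r * ∑ᶠ (χ S)
      inner-edges = trans (sym (∑²-+ (e G) (crossing G))) (trans (∑²-cong split) (degree-sum (χ S)))
        where
        split : ∀ u v → χ S u * χ S v * A G u v + χ S u * χ̄ S v * A G u v ≡ χ S u * A G u v
        split u v = trans (sym (*-distribʳ-+ (A G u v) (χ S u * χ S v) _))
          (cong (_* A G u v) (trans (sym (*-distribˡ-+ (χ S u) (χ S v) (χ̄ S v)))
            (trans (cong (χ S u *_) (χ+χ̄ S v)) (*-identityʳ (χ S u)))))

      outer-edges : ∑² (o G) + cut S G ≡ r * ∑ᶠ (χ̄ S)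
      outer-edges = trans (cong (∑² (o G) +_) (∑²-swap (crossing G)))
        (trans (sym (∑²-+ (o G) λ v u → crossing G u v)) (trans (∑²-cong split) (degree-sum (χ̄ S))))
        where
        split : ∀ u v → χ̄ S u * χ̄ S v * A G u v + χ S v * χ̄ S u * A G v u ≡ χ̄ S u * A G u v
        split u v = trans (cong (λ z → χ̄ S u * χ̄ S v * A G u v + χ S v * χ̄ S u * z) (A-comm G v u))
          (trans (sym (*-distribʳ-+ (A G u v) (χ̄ S u * χ̄ S v) _))
          (cong (_* A G u v) (trans (cong (χ̄ S u * χ̄ S v +_) (*-comm (χ S v) _))
            (trans (sym (*-distribˡ-+ (χ̄ S u) (χ̄ S v) (χ S v)))
            (trans (cong (χ̄ S u *_) (trans (+-comm (χ̄ S v) _) (χ+χ̄ S v))) (*-identityʳ (χ̄ S u)))))))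

      -- The quadruples that are ruled out since ac is already an edge.
      blocked : ∑² (λ a b → ∑² λ c d → e G a b * o G c d * A G a c) ≤ cut S G * (r * r)
      blocked = begin
        ∑² (λ a b → ∑² λ c d → e G a b * o G c d * A G a c)
          -- Forgetting the sides of `b` and `d` leaves a crossing edge `ac`, one of `r` neighbours
          -- `b` of `a` and one of `r` neighbours `d` of `c`.
          ≤⟨ ∑²-mono (λ a b → ∑²-mono λ c d → drop (χ S a) (𝟙≤1 (Vec.lookup S b)) (A G a b) (χ̄ S c) (𝟙≤1 (not (Vec.lookup S d))) (A G c d) (A G a c)) ⟩
        ∑² (λ a b → ∑² λ c d → crossing G a c * A G a b * A G c d)
          ≡⟨ ∑²-cong (λ a b → trans
               (∑-cong (allFin n) λ c → trans (∑-*ˡ (allFin n) (crossing G a c * A G a b) (A G c))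
                 (trans (cong (crossing G a c * A G a b *_) (∑-A c)) (*-assoc (crossing G a c) _ _)))
               (∑-*ʳ (allFin n) (crossing G a) (A G a b * r))) ⟩
        ∑² (λ a b → ∑ᶠ (crossing G a) * (A G a b * r))
          ≡⟨ ∑-cong (allFin n) (λ a → trans (∑-*ˡ (allFin n) (∑ᶠ (crossing G a)) _)
               (cong (∑ᶠ (crossing G a) *_) (trans (∑-*ʳ (allFin n) (A G a) r) (cong (_* r) (∑-A a))))) ⟩
        ∑ᶠ (λ a → ∑ᶠ (crossing G a) * (r * r))
          ≡⟨ ∑-*ʳ (allFin n) (λ a → ∑ᶠ (crossing G a)) (r * r) ⟩
        cut S G * (r * r) ∎
        where
        open ≤-Reasoning
        drop : ∀ a {b} → b ≤ 1 → ∀ x c {d} → d ≤ 1 → ∀ y z →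
               (a * b * x) * (c * d * y) * z ≤ (a * c) * z * x * y
        drop a {b} b≤1 x c {d} d≤1 y z = begin
          (a * b * x) * (c * d * y) * z ≤⟨ *-monoˡ-≤ z (*-mono-≤ (*-monoˡ-≤ x (*-monoʳ-≤ a b≤1)) (*-monoˡ-≤ y (*-monoʳ-≤ c d≤1))) ⟩
          (a * 1 * x) * (c * 1 * y) * z ≡⟨ solve 5 (λ a x c y z → (a :* con 1 :* x) :* (c :* con 1 :* y) :* z := (a :* c) :* z :* x :* y) refl a x c y z ⟩
          (a * c) * z * x * y ∎

      blocked′ : ∑² (λ a b → ∑² λ c d → e G a b * o G c d * A G b d) ≤ cut S G * (r * r)
      blocked′ = ≤-trans (≤-reflexive (trans (∑⁴-swap λ a b c d → e G a b * o G c d * A G b d) (∑²-cong λ a b → ∑²-cong λ c d →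
        cong (_* A G a c) (cong₂ _*_ (e-comm b a) (o-comm d c))))) blocked
        where
        e-comm : ∀ a b → e G a b ≡ e G b a
        e-comm a b = cong₂ _*_ (*-comm (χ S a) _) (A-comm G a b)
        o-comm : ∀ a b → o G a b ≡ o G b a
        o-comm a b = cong₂ _*_ (*-comm (χ̄ S a) _) (A-comm G a b)

      -- An edge inside and an edge outside can be switched unless `ac` or `bd` is an edge; each of
      -- the two obstructions accounts for at most `cut S G * (r * r)` quadruples.
      forward-many : ∑² (e G) * ∑² (o G) ≤ ∑ (quads n) (forward G) + 2 * (cut S G * (r * r))
      forward-many = begin
        ∑² (e G) * ∑² (o G)
          ≡⟨ trans (sym (∑²-*ʳ (e G) (∑² (o G)))) (∑²-cong λ a b → sym (∑²-*ˡ (e G a b) (o G))) ⟩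
        ∑² (λ a b → ∑² λ c d → e G a b * o G c d)
          ≤⟨ ∑²-mono (λ a b → ∑²-mono λ c d → cover (e G a b * o G c d) (adj G a c) (adj G b d)) ⟩
        ∑² (λ a b → ∑² λ c d → forward G ((a , b) , (c , d)) + (e G a b * o G c d * A G a c + e G a b * o G c d * A G b d))
          ≡⟨ trans (∑⁴-+ (λ a b c d → forward G ((a , b) , (c , d))) (λ a b c d → e G a b * o G c d * A G a c + e G a b * o G c d * A G b d))
               (cong₂ _+_ (sym (∑-quads (forward G)))
                 (∑⁴-+ (λ a b c d → e G a b * o G c d * A G a c) (λ a b c d → e G a b * o G c d * A G b d))) ⟩
        ∑ (quads n) (forward G) + (∑² (λ a b → ∑² λ c d → e G a b * o G c d * A G a c) + ∑² (λ a b → ∑² λ c d → e G a b * o G c d * A G b d))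
          ≤⟨ +-monoʳ-≤ (∑ (quads n) (forward G)) (+-mono-≤ blocked blocked′) ⟩
        ∑ (quads n) (forward G) + (cut S G * (r * r) + cut S G * (r * r))
          ≡⟨ cong (λ z → ∑ (quads n) (forward G) + (cut S G * (r * r) + z)) (sym (+-identityʳ _)) ⟩
        ∑ (quads n) (forward G) + 2 * (cut S G * (r * r)) ∎
        where
        open ≤-Reasoning
        cover : ∀ m x y → m ≤ m * (𝟙 (not x) * 𝟙 (not y)) + (m * 𝟙 x + m * 𝟙 y)
        cover m true  y     = ≤-trans (≤-reflexive (sym (*-identityʳ m))) (≤-trans (m≤m+n (m * 1) _) (m≤n+m _ (m * 0)))
        cover m false true  = ≤-trans (≤-reflexive (sym (*-identityʳ m))) (≤-trans (m≤n+m (m * 1) (m * 0)) (m≤n+m _ (m * 0)))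
        cover m false false = ≤-trans (≤-reflexive (sym (*-identityʳ m))) (m≤m+n (m * 1) _)

    backward-few : ∀ G → ∑ (quads n) (backward G) ≡ cut S G * cut S G
    backward-few G = trans (∑-quads (backward G))
      (trans (∑²-cong λ a b → ∑-*-∑ (allFin n) (allFin n) (crossing G a) (crossing G b))
        (∑-*-∑ (allFin n) (allFin n) (λ a → ∑ᶠ (crossing G a)) (λ b → ∑ᶠ (crossing G b))))

    positive-factors : ∀ {m n} → 1 ≤ m * n → 1 ≤ m × 1 ≤ n
    positive-factors {zero}  {n}     ()
    positive-factors {suc m} {zero}  le = case ≤-trans le (≤-reflexive (*-zeroʳ m)) of λ ()
    positive-factors {suc m} {suc n} _  = s≤s z≤n , s≤s z≤n

    𝟙-positive : ∀ {b} → 1 ≤ 𝟙 b → b ≡ true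
    𝟙-positive {true} _ = refl

    𝟙-not-positive : ∀ {b} → 1 ≤ 𝟙 (not b) → b ≡ false
    𝟙-not-positive {false} _ = refl

    ⟦⟧-positive : ∀ {P : Set} (P? : Dec P) → 1 ≤ ⟦ P? ⟧ → P
    ⟦⟧-positive (yes p) _ = p

    1≤𝟙 : ∀ {b} → b ≡ true → 1 ≤ 𝟙 b
    1≤𝟙 refl = ≤-refl

    bit≤ : ∀ {m k} → m ≤ 1 → (1 ≤ m → 1 ≤ k) → m ≤ k
    bit≤ {zero}  _         h = z≤n
    bit≤ {suc m} (s≤s z≤n) h = h ≤-refl

    -- Both sides are products of bits, so it suffices that the right one is positive when the left
    -- one is; positivity of the left one unfolds into the hypotheses of `Switch`.
    switch-class : ∀ (j : ℕ) (G : Graph n) (q : Quad n) → let ((a , b) , (c , d)) = q in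
      class j G * forward G q ≤
      class (2 + j) (switch a b c d G) * backward (switch a b c d G) q
    switch-class j G ((a , b) , (c , d)) = bit≤
      (*-mono-≤ (*-mono-≤ (𝟙≤1 (does (regular? r G))) (𝟙≤1 (does (cut S G ≟ j))))
        (*-mono-≤ (*-mono-≤ (*-mono-≤ (*-mono-≤ (𝟙≤1 (Vec.lookup S a)) (𝟙≤1 (Vec.lookup S b))) (𝟙≤1 (adj G a b)))
                            (*-mono-≤ (*-mono-≤ (𝟙≤1 (not (Vec.lookup S c))) (𝟙≤1 (not (Vec.lookup S d)))) (𝟙≤1 (adj G c d))))
                  (*-mono-≤ (𝟙≤1 (not (adj G a c))) (𝟙≤1 (not (adj G b d))))))
      λ pos →
        let cl , fw             = positive-factors pos
            reg , cutj          = positive-factors cl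
            eo , nn             = positive-factors fw
            nac , nbd           = positive-factors {Ā G a c} nn
            eab , ocd           = positive-factors {e G a b} eo
            ab∈ , ab            = positive-factors {χ S a * χ S b} eab
            cd∉ , cd            = positive-factors {χ̄ S c * χ̄ S d} ocd
            a∈ , b∈             = positive-factors {χ S a} ab∈
            c∉ , d∉             = positive-factors {χ̄ S c} cd∉
            module Sw = Switch S G (𝟙-positive a∈) (𝟙-positive b∈) (𝟙-not-positive c∉) (𝟙-not-positive d∉)
                          (𝟙-positive ab) (𝟙-positive cd) (𝟙-not-positive nac) (𝟙-not-positive nbd)
            regular  = ⟦⟧-positive (regular? r G) reg
            H        = switch a b c d G
            regular′ = deg⇒Regular H λ x → trans (Sw.switch-deg x) (Regular⇒deg G regular x)
        in *-mono-≤ {1} {_} {1}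
             (*-mono-≤ {1} {_} {1} (≤-reflexive (sym (⟦⟧-yes (regular? r H) regular′)))
               (≤-reflexive (sym (⟦⟧-yes (cut S H ≟ 2 + j) (trans Sw.switch-cut (cong (2 +_) (⟦⟧-positive (cut S G ≟ j) cutj)))))))
             (*-mono-≤ {1} {_} {1} (*-mono-≤ {1} {_} {1} (*-mono-≤ {1} {_} {1} a∈ c∉) (1≤𝟙 Sw.switched-ac))
               (*-mono-≤ {1} {_} {1} (*-mono-≤ {1} {_} {1} b∈ d∉) (1≤𝟙 Sw.switched-bd)))

    class-≤ : ∀ (j : ℕ) (G : Graph n) {f g} → (Regular r G → cut S G ≡ j → f ≤ g) → class j G * f ≤ class j G * g
    class-≤ j G h = go (regular? r G) (cut S G ≟ j) h
      where
      go : ∀ {P Q : Set} (P? : Dec P) (Q? : Dec Q) {f g} → (P → Q → f ≤ g) → ⟦ P? ⟧ * ⟦ Q? ⟧ * f ≤ ⟦ P? ⟧ * ⟦ Q? ⟧ * g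
      go (no _)  _       h = z≤n
      go (yes _) (no _)  h = z≤n
      go (yes p) (yes q) h = *-monoʳ-≤ 1 (h p q)

  -- Counts the pairs of a graph `G` and a quadruple that can be switched in it. Every `G` in the
  -- class of `j` has at least `f` of them. For a fixed quadruple the switching is injective, so the
  -- pairs embed into those of a graph with cut `2 + j` and two ordered crossing edges of it.
  switching : ∀ j f → f + 2 * (j * (r * r)) ≤ (r * ∑ᶠ (χ S) ∸ j) * (r * ∑ᶠ (χ̄ S) ∸ j) →
              #cut j * f ≤ #cut (2 + j) * ((2 + j) * (2 + j))
  switching j f bound = begin
    #cut j * f
      ≡⟨ ∑-*ʳ (graphs n) (class j) f ⟨
    ∑[ G ∈ graphs n ] class j G * f
      ≤⟨ ∑-mono (graphs n) (λ G → class-≤ j G (many G)) ⟩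
    ∑[ G ∈ graphs n ] class j G * ∑ (quads n) (forward G)
      ≡⟨ ∑-cong (graphs n) (λ G → sym (∑-*ˡ (quads n) (class j G) (forward G))) ⟩
    ∑[ G ∈ graphs n ] ∑[ q ∈ quads n ] class j G * forward G q
      ≡⟨ ∑-swap (graphs n) (quads n) _ ⟩
    ∑[ q ∈ quads n ] ∑[ G ∈ graphs n ] class j G * forward G q
      ≤⟨ ∑-mono (quads n) (λ q → let ((a , b) , (c , d)) = q in ≤-trans
           (∑-mono (graphs n) (λ G → switch-class j G q))
           (∑-injection (graphs-unique n) ∈-graphs (switch a b c d) (switch-injective a b c d) _≟ᴳ_
              λ G → class (2 + j) G * backward G q)) ⟩
    ∑[ q ∈ quads n ] ∑[ G ∈ graphs n ] class (2 + j) G * backward G q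
      ≡⟨ ∑-swap (graphs n) (quads n) _ ⟨
    ∑[ G ∈ graphs n ] ∑[ q ∈ quads n ] class (2 + j) G * backward G q
      ≡⟨ ∑-cong (graphs n) (λ G → ∑-*ˡ (quads n) (class (2 + j) G) (backward G)) ⟩
    ∑[ G ∈ graphs n ] class (2 + j) G * ∑ (quads n) (backward G)
      ≤⟨ ∑-mono (graphs n) (λ G → class-≤ (2 + j) G λ _ eq →
           ≤-reflexive (trans (backward-few G) (cong (λ z → z * z) eq))) ⟩
    ∑[ G ∈ graphs n ] class (2 + j) G * ((2 + j) * (2 + j))
      ≡⟨ ∑-*ʳ (graphs n) (class (2 + j)) _ ⟩
    #cut (2 + j) * ((2 + j) * (2 + j)) ∎
    where
    open ≤-Reasoning
    many : ∀ G → Regular r G → cut S G ≡ j → f ≤ ∑ (quads n) (forward G)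
    many G reg refl = +-cancelʳ-≤ (2 * (cut S G * (r * r))) _ _ (begin
      f + 2 * (cut S G * (r * r))
        ≤⟨ bound ⟩
      (r * ∑ᶠ (χ S) ∸ cut S G) * (r * ∑ᶠ (χ̄ S) ∸ cut S G)
        ≡⟨ cong₂ _*_ (trans (cong (_∸ cut S G) (sym (inner-edges G reg))) (m+n∸n≡m _ (cut S G)))
                     (trans (cong (_∸ cut S G) (sym (outer-edges G reg))) (m+n∸n≡m _ (cut S G))) ⟩
      ∑² (e G) * ∑² (o G)
        ≤⟨ forward-many G reg ⟩
      ∑ (quads n) (forward G) + 2 * (cut S G * (r * r)) ∎)

  degree-sum-inside : ∀ G → Regular r G →
    ∑² (λ a b → χ S a * χ S b * A G a b) + cut S G ≡ r * ∑ᶠ (χ S)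
  degree-sum-inside = inner-edges

-- Binomial coefficients

nC0≡1 : ∀ n → n C 0 ≡ 1
nC0≡1 n = trans (nCk≡nC[n∸k] {0} {n} z≤n) (nCn≡1 n)

pascal : ∀ n k → suc n C suc k ≡ n C k + n C suc k
pascal n k = sym (nCk+nC[k+1]≡[n+1]C[k+1] n k)

-- The form of `absorption` without subtraction, which allows induction by Pascal's rule.
absorption⁺ : ∀ n k → suc k * (n C suc k) + k * (n C k) ≡ n * (n C k)
absorption⁺ zero    zero    = refl
absorption⁺ zero    (suc k) = trans (cong₂ _+_ (*-zeroʳ (2 + k)) (*-zeroʳ (suc k))) refl
absorption⁺ (suc n) zero    = begin
  1 * (suc n C 1) + 0 ≡⟨ trans (+-identityʳ _) (*-identityˡ _) ⟩
  suc n C 1           ≡⟨ nC1≡n (suc n) ⟩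
  suc n               ≡⟨ *-identityʳ (suc n) ⟨
  suc n * 1           ≡⟨ cong (suc n *_) (nC0≡1 (suc n)) ⟨
  suc n * (suc n C 0) ∎
  where open ≡-Reasoning
absorption⁺ (suc n) (suc k) = begin
  (2 + k) * (suc n C (2 + k)) + (1 + k) * (suc n C suc k)
    ≡⟨ cong₂ (λ x y → (2 + k) * x + (1 + k) * y) (pascal n (suc k)) (pascal n k) ⟩
  (2 + k) * (c₁ + c₂) + (1 + k) * (c₀ + c₁)
    ≡⟨ solve 4 (λ k c₀ c₁ c₂ → (con 2 :+ k) :* (c₁ :+ c₂) :+ (con 1 :+ k) :* (c₀ :+ c₁) :=
         ((con 2 :+ k) :* c₂ :+ (con 1 :+ k) :* c₁) :+ ((con 1 :+ k) :* c₁ :+ k :* c₀) :+ (c₀ :+ c₁)) refl k c₀ c₁ c₂ ⟩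
  ((2 + k) * c₂ + (1 + k) * c₁) + ((1 + k) * c₁ + k * c₀) + (c₀ + c₁)
    ≡⟨ cong₂ (λ x y → x + y + (c₀ + c₁)) (absorption⁺ n (suc k)) (absorption⁺ n k) ⟩
  n * c₁ + n * c₀ + (c₀ + c₁)
    ≡⟨ solve 3 (λ n c₀ c₁ → n :* c₁ :+ n :* c₀ :+ (c₀ :+ c₁) := (con 1 :+ n) :* (c₀ :+ c₁)) refl n c₀ c₁ ⟩
  suc n * (c₀ + c₁)
    ≡⟨ cong (suc n *_) (pascal n k) ⟨
  suc n * (suc n C suc k) ∎
  where
  open ≡-Reasoning
  c₀ = n C k
  c₁ = n C suc k
  c₂ = n C (2 + k)

absorption : ∀ n k → suc k * (n C suc k) ≡ (n ∸ k) * (n C k)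
absorption n k = begin
  suc k * (n C suc k)                             ≡⟨ m+n∸n≡m _ (k * (n C k)) ⟨
  suc k * (n C suc k) + k * (n C k) ∸ k * (n C k) ≡⟨ cong (_∸ k * (n C k)) (absorption⁺ n k) ⟩
  n * (n C k) ∸ k * (n C k)                       ≡⟨ *-distribʳ-∸ (n C k) n k ⟨
  (n ∸ k) * (n C k)                               ∎
  where open ≡-Reasoning

-- The Cauchy product: the sum of `f j * g i` over `i + j = c`. The recursion removes the summand
-- `g 0`; `conv-peel` removes the one at the other end.
conv : (ℕ → ℕ) → (ℕ → ℕ) → ℕ → ℕ
conv f g zero    = f 0 * g 0
conv f g (suc c) = f (suc c) * g 0 + conv f (g ∘ suc) c

conv-peel : ∀ f g c → conv f g (suc c) ≡ conv (f ∘ suc) g c + f 0 * g (suc c)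
conv-peel f g zero    = refl
conv-peel f g (suc c) = trans (cong (f (2 + c) * g 0 +_) (conv-peel f (g ∘ suc) c)) (sym (+-assoc (f (2 + c) * g 0) _ _))

conv-cong : ∀ {f f′} g c → (∀ i → f i ≡ f′ i) → conv f g c ≡ conv f′ g c
conv-cong g zero    eq = cong (_* g 0) (eq 0)
conv-cong g (suc c) eq = cong₂ _+_ (cong (_* g 0) (eq (suc c))) (conv-cong (g ∘ suc) c eq)

conv-+ : ∀ f f′ g c → conv (λ i → f i + f′ i) g c ≡ conv f g c + conv f′ g c
conv-+ f f′ g zero    = *-distribʳ-+ (g 0) (f 0) (f′ 0)
conv-+ f f′ g (suc c) = trans (cong₂ _+_ (*-distribʳ-+ (g 0) (f (suc c)) (f′ (suc c))) (conv-+ f f′ (g ∘ suc) c))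
  (interchange (f (suc c) * g 0) (f′ (suc c) * g 0) _ _)

conv-term : ∀ f g i j → f j * g i ≤ conv f g (i + j)
conv-term f g zero    zero    = ≤-refl
conv-term f g zero    (suc j) = m≤m+n _ _
conv-term f g (suc i) j       = ≤-trans (conv-term f (g ∘ suc) i j) (m≤n+m _ _)

conv-≤ : ∀ f g c X {Y} → (∀ i j → i + j ≡ c → X * (f j * g i) ≤ Y) → X * conv f g c ≤ suc c * Y
conv-≤ f g zero    X {Y} h = ≤-trans (h 0 0 refl) (m≤m+n Y 0)
conv-≤ f g (suc c) X {Y} h = ≤-trans (≤-reflexive (*-distribˡ-+ X _ _))
  (+-mono-≤ (h 0 (suc c) refl) (conv-≤ f (g ∘ suc) c X λ i j eq → h (suc i) j (cong suc eq)))

vandermonde : ∀ a b c → conv (a C_) (b C_) c ≡ (a + b) C c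
vandermonde zero b zero = trans (*-identityˡ _) refl
vandermonde zero b (suc c) = trans (conv-peel (0 C_) (b C_) c)
  (cong₂ _+_ (vanish (b C_) c) (*-identityˡ (b C suc c)))
  where
  vanish : ∀ g c → conv (λ i → 0 C suc i) g c ≡ 0
  vanish g zero    = refl
  vanish g (suc c) = vanish (g ∘ suc) c
vandermonde (suc a) b zero = trans (cong₂ _*_ (nC0≡1 (suc a)) (nC0≡1 b)) (sym (nC0≡1 (suc a + b)))
vandermonde (suc a) b (suc c) = begin
  conv (suc a C_) (b C_) (suc c)
    ≡⟨ conv-peel (suc a C_) (b C_) c ⟩
  conv (λ i → suc a C suc i) (b C_) c + (suc a C 0) * (b C suc c)
    ≡⟨ cong₂ _+_ (trans (conv-cong (b C_) c (pascal a)) (conv-+ (a C_) (λ i → a C suc i) (b C_) c))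
                 (cong (_* (b C suc c)) (trans (nC0≡1 (suc a)) (sym (nC0≡1 a)))) ⟩
  conv (a C_) (b C_) c + conv (λ i → a C suc i) (b C_) c + (a C 0) * (b C suc c)
    ≡⟨ trans (+-assoc (conv (a C_) (b C_) c) _ _) (cong (conv (a C_) (b C_) c +_) (sym (conv-peel (a C_) (b C_) c))) ⟩
  conv (a C_) (b C_) c + conv (a C_) (b C_) (suc c)
    ≡⟨ cong₂ _+_ (vandermonde a b c) (vandermonde a b (suc c)) ⟩
  (a + b) C c + (a + b) C suc c
    ≡⟨ pascal (a + b) c ⟨
  (suc a + b) C suc c ∎
  where open ≡-Reasoning

-- A single summand of Vandermonde's convolution.
C-*-≤ : ∀ a b i j → (a C i) * (b C j) ≤ (a + b) C (i + j)
C-*-≤ a b i j = ≤-trans (conv-term (a C_) (b C_) j i)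
  (≤-reflexive (trans (vandermonde a b (j + i)) (cong ((a + b) C_) (+-comm j i))))

-- Among the `k`-subsets of `k` blocks of size `m` are those with one element from each block.
^≤C : ∀ m k → m ^ k ≤ (k * m) C k
^≤C m zero    = ≤-refl
^≤C m (suc k) = ≤-trans (*-mono-≤ (≤-reflexive (sym (nC1≡n m))) (^≤C m k)) (C-*-≤ m (k * m) 1 k)

C-shift-≤ : ∀ a b k → a C k ≤ (a + b) C (k + b)
C-shift-≤ a b k = ≤-trans (≤-reflexive (trans (sym (*-identityʳ _)) (cong ((a C k) *_) (sym (nCn≡1 b))))) (C-*-≤ a b k b)

-- Iterated switching ratios and their summation

module Chain (X : ℕ → ℕ) (p q : ℕ)
  (ratio : ∀ k → X k * ((p ∸ k) * (q ∸ k)) ≤ X (suc k) * ((2 + k) * (2 + k))) where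

  private
    Y = suc p * suc q

  -- By absorption `(k + 2) C(p + 1, k + 2) = (p − k) C(p + 1, k +
  -- 1)`, and likewise for `q`, so one use of `ratio` advances both binomials. The denominators
  -- `2 + k` cause the shift of the indices by one, and `Y` is the product of the binomials at
  -- `k = 0`.
  chain : ∀ k → X 0 * ((suc p C suc k) * (suc q C suc k)) ≤ Y * X k
  chain zero = ≤-reflexive (trans (cong (X 0 *_) (cong₂ _*_ (nC1≡n (suc p)) (nC1≡n (suc q)))) (*-comm (X 0) Y))
  chain (suc k) = *-cancelʳ-≤ _ _ ((2 + k) * (2 + k)) (begin
    X 0 * (P′ * Q′) * ((2 + k) * (2 + k))
      ≡⟨ solve 4 (λ x p q k → x :* (p :* q) :* (k :* k) := x :* ((k :* p) :* (k :* q))) refl (X 0) P′ Q′ (2 + k) ⟩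
    X 0 * (((2 + k) * P′) * ((2 + k) * Q′))
      ≡⟨ cong (X 0 *_) (cong₂ _*_ (absorption (suc p) (suc k)) (absorption (suc q) (suc k))) ⟩
    X 0 * (((p ∸ k) * P) * ((q ∸ k) * Q))
      ≡⟨ solve 5 (λ x p q i j → x :* ((i :* p) :* (j :* q)) := x :* (p :* q) :* (i :* j)) refl (X 0) P Q (p ∸ k) (q ∸ k) ⟩
    X 0 * (P * Q) * ((p ∸ k) * (q ∸ k))
      ≤⟨ *-monoˡ-≤ _ (chain k) ⟩
    Y * X k * ((p ∸ k) * (q ∸ k))
      ≡⟨ *-assoc Y (X k) _ ⟩
    Y * (X k * ((p ∸ k) * (q ∸ k)))
      ≤⟨ *-monoʳ-≤ Y (ratio k) ⟩
    Y * (X (suc k) * ((2 + k) * (2 + k)))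
      ≡⟨ *-assoc Y (X (suc k)) _ ⟨
    Y * X (suc k) * ((2 + k) * (2 + k)) ∎)
    where
    open ≤-Reasoning
    P = suc p C suc k
    Q = suc q C suc k
    P′ = suc p C (2 + k)
    Q′ = suc q C (2 + k)

  -- The symmetry of `C(p + 1, _)` makes the products in `chain` the summands of Vandermonde's
  -- convolution in degree `p + 1`. It has `2 + p` summands, each bounded by `Y * T` after
  -- multiplication by `X 0`.
  chain-sum : ∀ {T} → (∀ k → X k ≤ T) → X 0 * ((suc p + suc q) C suc p) ≤ (2 + p) * (Y * T)
  chain-sum {T} X≤T = ≤-trans (≤-reflexive (cong (X 0 *_) (sym (vandermonde (suc p) (suc q) (suc p)))))
    (conv-≤ (suc p C_) (suc q C_) (suc p) (X 0) term)
    where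
    term : ∀ i j → i + j ≡ suc p → X 0 * ((suc p C j) * (suc q C i)) ≤ Y * T
    -- `chain k` takes care of the summand `i = k + 1`. The remaining one is just `X 0`, and `Y` is
    -- at least 1.
    term zero    j refl = begin
      X 0 * ((j C j) * (suc q C 0)) ≡⟨ cong (X 0 *_) (cong₂ _*_ (nCn≡1 j) (nC0≡1 (suc q))) ⟩
      X 0 * 1                       ≡⟨ *-identityʳ (X 0) ⟩
      X 0                           ≤⟨ X≤T 0 ⟩
      T                             ≤⟨ m≤m+n T _ ⟩
      Y * T                         ∎
      where open ≤-Reasoning
    term (suc k) j eq = begin
      X 0 * ((suc p C j) * (suc q C suc k))
        ≡⟨ cong (λ z → X 0 * ((suc p C z) * (suc q C suc k))) (trans (sym (m+n∸m≡n (suc k) j)) (cong (_∸ suc k) eq)) ⟩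
      X 0 * ((suc p C (suc p ∸ suc k)) * (suc q C suc k))
        ≡⟨ cong (λ z → X 0 * (z * (suc q C suc k))) (nCk≡nC[n∸k] (≤-trans (m≤m+n (suc k) j) (≤-reflexive eq))) ⟨
      X 0 * ((suc p C suc k) * (suc q C suc k))
        ≤⟨ chain k ⟩
      Y * X k
        ≤⟨ *-monoʳ-≤ Y (X≤T k) ⟩
      Y * T ∎
      where open ≤-Reasoning

-- Numerical lower bound for the number of switchings

≤-by : ∀ {m n} k → m + k ≡ n → m ≤ n
≤-by k refl = m≤m+n _ k

-- s and s̄ are the sizes of S and its complement; the term 2jr² accounts for the switchings that
-- are blocked by an edge ac or bd.
module _ {r h m M n s̄ q j₀ k x y : ℕ}
  (3≤r : 3 ≤ r) (R≤M : r * r ≤ M) (j₀≤2 : j₀ ≤ 2) (m≤3 : m ≤ 3)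
  (s+s̄ : 4 * suc h + m + s̄ ≡ n) (2s≤n : 2 * (4 * suc h + m) ≤ n) (160M≤n : 160 * M ≤ n)
  (p+q : 5 * suc h + m + q + 2 ≡ n + 30 * M) (p≡ : 5 * suc h + m ≡ k + suc x) (q≡ : q ≡ k + y) where

  private
    R = r * r
    s = 4 * suc h + m
    p = 5 * suc h + m
    j = k * 2 + j₀
    e = 2 * h + m

    j≤ : j ≤ k * 2 + 2
    j≤ = +-monoʳ-≤ (k * 2) j₀≤2

    -- Since `3s = 2p + e + 2` and `j ≤ 2k + 2`, the difference `3s − j` is at least `2(p − k) + e`:
    -- the slack `e`, about `s / 2`, is what the choice of `p` below `3s / 2` saves.
    inner-bound : 2 * suc x + e ≤ r * s ∸ j
    inner-bound = m+n≤o⇒m≤o∸n (2 * suc x + e) (begin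
      2 * suc x + e + j           ≤⟨ +-monoʳ-≤ (2 * suc x + e) j≤ ⟩
      2 * suc x + e + (k * 2 + 2) ≡⟨ solve 4 (λ x k h m → con 2 :* (con 1 :+ x) :+ (con 2 :* h :+ m) :+ (k :* con 2 :+ con 2) :=
                                       con 2 :* (k :+ (con 1 :+ x)) :+ (con 2 :* h :+ m :+ con 2)) refl x k h m ⟩
      2 * (k + suc x) + (e + 2)   ≡⟨ cong (λ z → 2 * z + (e + 2)) p≡ ⟨
      2 * p + (e + 2)             ≡⟨ solve 2 (λ h m → con 2 :* (con 5 :* (con 1 :+ h) :+ m) :+ (con 2 :* h :+ m :+ con 2) :=
                                       con 3 :* (con 4 :* (con 1 :+ h) :+ m)) refl h m ⟩
      3 * s                       ≤⟨ *-monoˡ-≤ s 3≤r ⟩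
      r * s                       ∎)
      where open ≤-Reasoning

    -- Here `2 * suc h + m` is `3s − 2p`, roughly `s / 2` and so roughly at most `n / 4`. The other
    -- terms are at most `70M`, whereas `3n / 4` is at least `120M`.
    size-bound : 60 * M + 10 * R + (2 * suc h + m) ≤ n + 2
    size-bound = *-cancelˡ-≤ 4 (begin
      4 * (60 * M + 10 * R + (2 * suc h + m))
        ≡⟨ solve 4 (λ M R h m → con 4 :* (con 60 :* M :+ con 10 :* R :+ (con 2 :* (con 1 :+ h) :+ m)) :=
             con 240 :* M :+ con 40 :* R :+ con 2 :* (con 4 :* (con 1 :+ h) :+ m) :+ con 2 :* m) refl M R h m ⟩
      240 * M + 40 * R + 2 * s + 2 * m
        ≤⟨ +-mono-≤ (+-mono-≤ (+-monoʳ-≤ (240 * M) (*-monoʳ-≤ 40 R≤M)) 2s≤n) (*-monoʳ-≤ 2 m≤3) ⟩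
      240 * M + 40 * M + n + 6
        ≤⟨ ≤-by (200 * M + 2) (solve 2 (λ M n → con 240 :* M :+ con 40 :* M :+ n :+ con 6 :+ (con 200 :* M :+ con 2) :=
             con 3 :* (con 160 :* M) :+ n :+ con 8) refl M n) ⟩
      3 * (160 * M) + n + 8
        ≤⟨ +-monoˡ-≤ 8 (+-monoˡ-≤ n (*-monoʳ-≤ 3 160M≤n)) ⟩
      3 * n + n + 8
        ≡⟨ solve 1 (λ n → con 3 :* n :+ n :+ con 8 := con 4 :* (n :+ con 2)) refl n ⟩
      4 * (n + 2) ∎)
      where open ≤-Reasoning

    -- After elimination of `q` and `s̄` by `p+q` and `s+s̄`, the inequality
    -- `2(q − k) + 10R ≤ 3s̄ − 2k − 2` is `size-bound`.
    outer-bound : 2 * y + 10 * R ≤ r * s̄ ∸ j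
    outer-bound = m+n≤o⇒m≤o∸n (2 * y + 10 * R) (≤-trans (+-cancelʳ-≤ (3 * s + 2 * p + 2) _ _ (begin
      2 * y + 10 * R + j + (3 * s + 2 * p + 2)
        ≤⟨ +-monoˡ-≤ (3 * s + 2 * p + 2) (+-monoʳ-≤ (2 * y + 10 * R) j≤) ⟩
      2 * y + 10 * R + (k * 2 + 2) + (3 * s + 2 * p + 2)
        ≡⟨ solve 5 (λ y R k s p → con 2 :* y :+ con 10 :* R :+ (k :* con 2 :+ con 2) :+ (con 3 :* s :+ con 2 :* p :+ con 2) :=
             con 2 :* (p :+ (k :+ y) :+ con 2) :+ con 10 :* R :+ con 3 :* s) refl y R k s p ⟩
      2 * (p + (k + y) + 2) + 10 * R + 3 * s
        ≡⟨ cong (λ z → 2 * z + 10 * R + 3 * s) (trans (cong (λ z → p + z + 2) (sym q≡)) p+q) ⟩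
      2 * (n + 30 * M) + 10 * R + 3 * s
        ≡⟨ solve 5 (λ n M R h m → con 2 :* (n :+ con 30 :* M) :+ con 10 :* R :+ con 3 :* (con 4 :* (con 1 :+ h) :+ m) :=
             con 60 :* M :+ con 10 :* R :+ (con 2 :* (con 1 :+ h) :+ m) :+ (con 2 :* n :+ con 2 :* (con 5 :* (con 1 :+ h) :+ m))) refl n M R h m ⟩
      60 * M + 10 * R + (2 * suc h + m) + (2 * n + 2 * p)
        ≤⟨ +-monoˡ-≤ (2 * n + 2 * p) size-bound ⟩
      n + 2 + (2 * n + 2 * p)
        ≡⟨ cong (λ n → n + 2 + (2 * n + 2 * p)) s+s̄ ⟨
      s + s̄ + 2 + (2 * (s + s̄) + 2 * p)
        ≡⟨ solve 3 (λ s s̄ p → s :+ s̄ :+ con 2 :+ (con 2 :* (s :+ s̄) :+ con 2 :* p) :=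
             con 3 :* s̄ :+ (con 3 :* s :+ con 2 :* p :+ con 2)) refl s s̄ p ⟩
      3 * s̄ + (3 * s + 2 * p + 2) ∎)) (*-monoˡ-≤ s̄ 3≤r))
      where open ≤-Reasoning

    -- As `k < p`, the left side is at most `4p`, about `5s`, which is ten times the slack `e`. This
    -- ten is the coefficient of `R` in `outer-bound`.
    loss-bound : 2 * j ≤ 10 * (2 + e)
    loss-bound = begin
      2 * j                   ≤⟨ *-monoʳ-≤ 2 j≤ ⟩
      2 * (k * 2 + 2)         ≤⟨ ≤-by (4 * x) (solve 2 (λ k x → con 2 :* (k :* con 2 :+ con 2) :+ con 4 :* x := con 4 :* (k :+ (con 1 :+ x))) refl k x) ⟩
      4 * (k + suc x)         ≡⟨ cong (4 *_) p≡ ⟨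
      4 * p                   ≤⟨ ≤-by (6 * m) (solve 2 (λ h m → con 4 :* (con 5 :* (con 1 :+ h) :+ m) :+ con 6 :* m :=
                                   con 10 :* (con 2 :+ (con 2 :* h :+ m))) refl h m) ⟩
      10 * (2 + e)            ∎
      where open ≤-Reasoning

  -- In the product of the two factors `2(x + 1) + e` and `2y + 10R`, the leading terms give
  -- `4(x + 1)y`, and `10R` times the first factor covers the blocked switchings by `loss-bound`.
  switchings-bound : 4 * (suc x * y) + 2 * (j * R) ≤ (r * s ∸ j) * (r * s̄ ∸ j)
  switchings-bound = begin
    4 * (suc x * y) + 2 * (j * R)
      ≡⟨ cong (4 * (suc x * y) +_) (sym (*-assoc 2 j R)) ⟩
    4 * (suc x * y) + 2 * j * R
      ≤⟨ +-monoʳ-≤ (4 * (suc x * y)) (*-monoˡ-≤ R loss-bound) ⟩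
    4 * (suc x * y) + 10 * (2 + e) * R
      ≤⟨ ≤-by (2 * e * y + 20 * x * R) (solve 4 (λ x y e R →
           con 4 :* ((con 1 :+ x) :* y) :+ con 10 :* (con 2 :+ e) :* R :+ (con 2 :* e :* y :+ con 20 :* x :* R) :=
           (con 2 :* (con 1 :+ x) :+ e) :* (con 2 :* y :+ con 10 :* R)) refl x y e R) ⟩
    (2 * suc x + e) * (2 * y + 10 * R)
      ≤⟨ *-mono-≤ inner-bound outer-bound ⟩
    (r * s ∸ j) * (r * s̄ ∸ j) ∎
    where open ≤-Reasoning

-- A fixed set rarely has a sparse boundary

⟦⟧-*-≤ : ∀ {P Q : Set} (P? : Dec P) (Q? : Dec Q) → ⟦ P? ⟧ * ⟦ Q? ⟧ ≤ ⟦ P? ⟧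
⟦⟧-*-≤ P? Q? = ≤-trans (*-monoʳ-≤ ⟦ P? ⟧ (𝟙≤1 (does Q?))) (≤-reflexive (*-identityʳ _))

#cut≤#regular : ∀ {n} r (S : Subset n) j → #cut r S j ≤ #regular r n
#cut≤#regular {n} r S j = ≤-trans (∑-mono (graphs n) λ G → ⟦⟧-*-≤ (regular? r G) (cut S G ≟ j))
  (≤-reflexive (sym (length-filter≡∑ (regular? r) (graphs n))))

∑χ+∑χ̄ : ∀ {n} (S : Subset n) → ∑ᶠ (χ S) + ∑ᶠ (χ̄ S) ≡ n
∑χ+∑χ̄ {n} S = trans (sym (∑-+ (allFin n) (χ S) (χ̄ S))) (trans (∑-cong (allFin n) (χ+χ̄ S))
  (trans (∑-const (allFin n) 1) (trans (*-identityʳ _) (length-tabulate id))))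

-- Starting from `C(uM, u)`, the ground set is enlarged by `t − u` elements that are always chosen
-- and by further elements that are never chosen; the hypothesis says that `w` has room for them.
^≤C⁺ : ∀ {M u t w} → u ≤ t → u * M + t ≤ w + u → M ^ u ≤ w C t
^≤C⁺ {M} {u} {t} {w} u≤t h with m≤n⇒∃[o]m+o≡n u≤t
... | b , refl with m≤n⇒∃[o]m+o≡n (+-cancelʳ-≤ u (u * M + b) w
                     (≤-trans (≤-reflexive (trans (+-assoc (u * M) b u) (cong (u * M +_) (+-comm b u)))) h))
...   | c , refl = begin
  M ^ u                           ≤⟨ ^≤C M u ⟩
  (u * M) C u                     ≡⟨ *-identityʳ _ ⟨
  ((u * M) C u) * 1               ≡⟨ cong (((u * M) C u) *_) (nC0≡1 c) ⟨
  ((u * M) C u) * (c C 0)         ≤⟨ C-*-≤ (u * M) c u 0 ⟩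
  (u * M + c) C (u + 0)           ≡⟨ cong ((u * M + c) C_) (+-identityʳ u) ⟩
  (u * M + c) C u                 ≤⟨ C-shift-≤ (u * M + c) b u ⟩
  (u * M + c + b) C (u + b)       ≡⟨ cong (_C (u + b)) (trans (+-assoc (u * M) c b) (trans (cong (u * M +_) (+-comm c b)) (sym (+-assoc (u * M) b c)))) ⟩
  (u * M + b + c) C (u + b)       ∎
  where open ≤-Reasoning

opaque
  -- The factor `(2 + p)(1 + p)(1 + q)` from `chain-sum` is at most `K₁ * M` if `p ≤ 18`, and at
  -- most `K₂ * M ^ 3` in general; `230 * M` bounds `n + 30 * M`.
  K₁ K₂ : ℕ
  K₁ = 20 * (19 * 230)
  K₂ = 230 * (230 * 230)

  K₁-spec : ∀ M → 20 * (19 * (230 * M)) ≡ K₁ * M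
  K₁-spec = solve 1 (λ M → con 20 :* (con 19 :* (con 230 :* M)) := con (20 * (19 * 230)) :* M) refl

  K₂-spec : ∀ M T → 230 * M * (230 * M * (230 * M)) * T ≡ K₂ * T * M ^ 3
  K₂-spec = solve 2 (λ M T → con 230 :* M :* (con 230 :* M :* (con 230 :* M)) :* T :=
    con (230 * (230 * 230)) :* T :* (M :* (M :* (M :* con 1)))) refl

module _ {n r M : ℕ} (3≤r : 3 ≤ r) (R≤M : r * r ≤ M) (5≤M : 5 ≤ M)
  (160M≤n : 160 * M ≤ n) (n≤160M : n ≤ 160 * M + 160) where

  private
    T = #regular r n

    -- The remainder 160 is absorbed by `40 * M` because `5 ≤ M`, and 230 is 160 + 40 + 30.
    total≤ : n + 30 * M ≤ 230 * M
    total≤ = begin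
      n + 30 * M                ≤⟨ +-monoˡ-≤ (30 * M) n≤160M ⟩
      160 * M + 160 + 30 * M    ≤⟨ +-monoˡ-≤ (30 * M) (+-monoʳ-≤ (160 * M) (≤-trans (≤-by 40 refl) (*-monoʳ-≤ 40 5≤M))) ⟩
      160 * M + 40 * M + 30 * M ≡⟨ solve 1 (λ M → con 160 :* M :+ con 40 :* M :+ con 30 :* M := con 230 :* M) refl M ⟩
      230 * M                  ∎
      where
      open ≤-Reasoning

    -- The chain of switchings gains the factor C(n + 30M, s + t) with t = h + 2, which exceeds the
    -- number C(n, s) of sets S by the factor C(30M, t).
    module Size (S : Subset n) (h m : ℕ) (m≤3 : m ≤ 3)
      (∣S∣ : ∑ᶠ (χ S) ≡ 4 * suc h + m) (2s≤n : 2 * (4 * suc h + m) ≤ n) where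

      s = 4 * suc h + m
      p = 5 * suc h + m
      q = n + 30 * M ∸ (p + 2)

      p+2≤n : p + 2 ≤ n
      p+2≤n = ≤-trans (≤-by (3 * h + m + 1) (solve 2 (λ h m → con 5 :* (con 1 :+ h) :+ m :+ con 2 :+ (con 3 :* h :+ m :+ con 1) :=
        con 2 :* (con 4 :* (con 1 :+ h) :+ m)) refl h m)) 2s≤n

      p+q : p + q + 2 ≡ n + 30 * M
      p+q = trans (solve 2 (λ p q → p :+ q :+ con 2 := p :+ con 2 :+ q) refl p q)
        (m+[n∸m]≡n (≤-trans p+2≤n (m≤m+n n _)))

      s+s̄ : s + ∑ᶠ (χ̄ S) ≡ n
      s+s̄ = trans (cong (_+ ∑ᶠ (χ̄ S)) (sym ∣S∣)) (∑χ+∑χ̄ S)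

      ratio : ∀ j₀ → j₀ ≤ 2 → ∀ k → #cut r S (k * 2 + j₀) * ((p ∸ k) * (q ∸ k)) ≤
                                    #cut r S (2 + (k * 2 + j₀)) * ((2 + k) * (2 + k))
      ratio j₀ j₀≤2 k with p ∸ k in eqp | q ∸ k in eqq
      ... | zero  | _     = ≤-trans (≤-reflexive (*-zeroʳ (#cut r S (k * 2 + j₀)))) z≤n
      ... | suc x | zero  = ≤-trans (≤-reflexive (trans (cong (#cut r S (k * 2 + j₀) *_) (*-zeroʳ (suc x))) (*-zeroʳ (#cut r S (k * 2 + j₀))))) z≤n
      -- As `j = 2k + j₀` with `j₀ ≤ 2`, the square of `2 + j` is at most `4(2 + k)²`, and this 4
      -- cancels the one in `switchings-bound`.
      ... | suc x | suc y = *-cancelˡ-≤ 4 (begin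
        4 * (X * (suc x * suc y))
          ≡⟨ solve 2 (λ X z → con 4 :* (X :* z) := X :* (con 4 :* z)) refl X (suc x * suc y) ⟩
        X * (4 * (suc x * suc y))
          ≤⟨ switching r S j (4 * (suc x * suc y)) (subst (λ s → 4 * (suc x * suc y) + 2 * (j * (r * r)) ≤ (r * s ∸ j) * (r * ∑ᶠ (χ̄ S) ∸ j)) (sym ∣S∣)
               (switchings-bound {h = h} {m} {M} {k = k} {x} 3≤r R≤M j₀≤2 m≤3 s+s̄ 2s≤n 160M≤n p+q (gap eqp) (gap eqq))) ⟩
        X′ * ((2 + j) * (2 + j))
          ≤⟨ *-monoʳ-≤ X′ (*-mono-≤ 2+j≤ 2+j≤) ⟩
        X′ * (2 * (2 + k) * (2 * (2 + k)))
          ≡⟨ solve 2 (λ X k → X :* (con 2 :* k :* (con 2 :* k)) := con 4 :* (X :* (k :* k))) refl X′ (2 + k) ⟩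
        4 * (X′ * ((2 + k) * (2 + k))) ∎)
        where
        open ≤-Reasoning
        j = k * 2 + j₀
        X = #cut r S j
        X′ = #cut r S (2 + j)
        2+j≤ : 2 + j ≤ 2 * (2 + k)
        2+j≤ = ≤-trans (+-monoʳ-≤ 2 (+-monoʳ-≤ (k * 2) j₀≤2))
          (≤-reflexive (solve 1 (λ k → con 2 :+ (k :* con 2 :+ con 2) := con 2 :* (con 2 :+ k)) refl k))
        gap : ∀ {a k z} → a ∸ k ≡ suc z → a ≡ k + suc z
        gap {a} {k} {z} eq = trans (sym (m+[n∸m]≡n {k} {a} (case ≤-total k a of λ
          { (inj₁ k≤a) → k≤a ; (inj₂ a≤k) → case trans (sym eq) (m≤n⇒m∸n≡0 a≤k) of λ () }))) (cong (k +_) eq)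

      rare : ∀ j₀ → j₀ ≤ 2 → #cut r S j₀ * (n C s) * ((30 * M) C (2 + h)) ≤ (2 + p) * (suc p * suc q) * T
      rare j₀ j₀≤2 = begin
        X * (n C s) * ((30 * M) C (2 + h))
          ≡⟨ *-assoc X (n C s) _ ⟩
        X * ((n C s) * ((30 * M) C (2 + h)))
          ≤⟨ *-monoʳ-≤ X (C-*-≤ n (30 * M) s (2 + h)) ⟩
        X * ((n + 30 * M) C (s + (2 + h)))
          ≡⟨ cong (X *_) (cong₂ _C_ (trans (sym p+q) (solve 2 (λ p q → p :+ q :+ con 2 := con 1 :+ p :+ (con 1 :+ q)) refl p q))
               (solve 2 (λ h m → con 4 :* (con 1 :+ h) :+ m :+ (con 2 :+ h) := con 1 :+ (con 5 :* (con 1 :+ h) :+ m)) refl h m)) ⟩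
        X * ((suc p + suc q) C suc p)
          ≤⟨ Chain.chain-sum (λ k → #cut r S (k * 2 + j₀)) p q (ratio j₀ j₀≤2) (λ k → #cut≤#regular r S (k * 2 + j₀)) ⟩
        (2 + p) * (suc p * suc q * T)
          ≡⟨ *-assoc (2 + p) (suc p * suc q) T ⟨
        (2 + p) * (suc p * suc q) * T ∎
        where
        open ≤-Reasoning
        X = #cut r S j₀

      2+p≤ : 2 + p ≤ 230 * M
      2+p≤ = ≤-trans (≤-by q (trans (solve 2 (λ p q → con 2 :+ p :+ q := p :+ q :+ con 2) refl p q) p+q)) total≤

      1+q≤ : suc q ≤ 230 * M
      1+q≤ = ≤-trans (≤-by (suc p) (trans (solve 2 (λ p q → con 1 :+ q :+ (con 1 :+ p) := p :+ q :+ con 2) refl p q) p+q)) total≤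

      h≤ : 8 * suc h ≤ 160 * M + 160
      h≤ = ≤-trans (≤-by (2 * m) (solve 2 (λ h m → con 8 :* (con 1 :+ h) :+ con 2 :* m := con 2 :* (con 4 :* (con 1 :+ h) :+ m)) refl h m))
        (≤-trans 2s≤n n≤160M)

      -- The origin of `30 * M`: from `8(h + 1) ≤ 2s ≤ n` follows `h + 2 ≤ 20M + 21`, and `5M` more
      -- for the power of `M` still leave `5M ≥ 25`.
      room : ∀ u → u ≤ 5 → u * M + (2 + h) ≤ 30 * M + u
      room u u≤5 = *-cancelˡ-≤ 8 (begin
        8 * (u * M + (2 + h))
          ≡⟨ solve 3 (λ u M h → con 8 :* (u :* M :+ (con 2 :+ h)) := con 8 :* (u :* M) :+ (con 8 :* (con 1 :+ h) :+ con 8)) refl u M h ⟩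
        8 * (u * M) + (8 * suc h + 8)
          ≤⟨ +-mono-≤ (*-monoʳ-≤ 8 (*-monoˡ-≤ M u≤5)) (≤-trans (+-monoˡ-≤ 8 h≤) (≤-reflexive (+-assoc (160 * M) 160 8))) ⟩
        8 * (5 * M) + (160 * M + 168)
          ≤⟨ +-monoʳ-≤ (8 * (5 * M)) (+-monoʳ-≤ (160 * M) (≤-trans (≤-by 32 refl) (*-monoʳ-≤ 40 5≤M))) ⟩
        8 * (5 * M) + (160 * M + 40 * M)
          ≤⟨ ≤-by (8 * u) (solve 2 (λ M u → con 8 :* (con 5 :* M) :+ (con 160 :* M :+ con 40 :* M) :+ con 8 :* u :=
               con 8 :* (con 30 :* M :+ u)) refl M u) ⟩
        8 * (30 * M + u) ∎)
        where open ≤-Reasoning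

      instance
        M≢0 : NonZero M
        M≢0 = >-nonZero (≤-trans (s≤s z≤n) 5≤M)

      -- For `h ≤ 2` the binomial is only known to exceed `M²`, but `p ≤ 5 * 3 + 3` makes the factor
      -- from `chain-sum` linear in `M`.
      rare-few : ∀ j₀ → j₀ ≤ 2 → h ≤ 2 → #cut r S j₀ * (n C s) * (M * M) ≤ K₁ * M * T
      rare-few j₀ j₀≤2 h≤2 = begin
        #cut r S j₀ * (n C s) * (M * M)
          ≤⟨ *-monoʳ-≤ (#cut r S j₀ * (n C s)) (≤-trans (≤-reflexive (cong (M *_) (sym (*-identityʳ M))))
               (^≤C⁺ {M} {2} (s≤s (s≤s z≤n)) (room 2 (s≤s (s≤s z≤n))))) ⟩
        #cut r S j₀ * (n C s) * ((30 * M) C (2 + h))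
          ≤⟨ rare j₀ j₀≤2 ⟩
        (2 + p) * (suc p * suc q) * T
          ≤⟨ *-monoˡ-≤ T (*-mono-≤ (+-monoʳ-≤ 2 p≤18) (*-mono-≤ (s≤s p≤18) 1+q≤)) ⟩
        20 * (19 * (230 * M)) * T
          ≡⟨ cong (_* T) (K₁-spec M) ⟩
        K₁ * M * T ∎
        where
        open ≤-Reasoning
        p≤18 : p ≤ 18
        p≤18 = +-mono-≤ (*-monoʳ-≤ 5 (s≤s h≤2)) m≤3

      -- For `h ≥ 3` the binomial exceeds `M⁵`; three of these powers cancel the cubic factor from
      -- `chain-sum`.
      rare-many : ∀ j₀ → j₀ ≤ 2 → 3 ≤ h → #cut r S j₀ * (n C s) * (M * M) ≤ K₂ * T
      rare-many j₀ j₀≤2 3≤h = *-cancelʳ-≤ _ _ (M ^ 3) {{m^n≢0 M 3}} (begin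
        X * (M * M) * M ^ 3
          ≡⟨ solve 2 (λ X M → X :* (M :* M) :* (M :* (M :* (M :* con 1))) := X :* (M :* (M :* (M :* (M :* (M :* con 1)))))) refl X M ⟩
        X * M ^ 5
          ≤⟨ *-monoʳ-≤ X (^≤C⁺ {M} {5} (s≤s (s≤s 3≤h)) (room 5 ≤-refl)) ⟩
        X * ((30 * M) C (2 + h))
          ≤⟨ rare j₀ j₀≤2 ⟩
        (2 + p) * (suc p * suc q) * T
          ≤⟨ *-monoˡ-≤ T (*-mono-≤ 2+p≤ (*-mono-≤ (≤-trans (n≤1+n _) 2+p≤) 1+q≤)) ⟩
        230 * M * (230 * M * (230 * M)) * T
          ≡⟨ K₂-spec M T ⟩
        K₂ * T * M ^ 3 ∎)
        where
        open ≤-Reasoning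
        X = #cut r S j₀ * (n C s)

  -- With `s = 4(h + 1) + m` and `m ≤ 3`, the case `h ≤ 2` is `s < 16`. Only these few sizes carry
  -- the larger term `K₁ * M`, so that the sum over all sizes remains linear in `M`.
  rare-cuts : ∀ (S : Subset n) j₀ → j₀ ≤ 2 → 4 ≤ Subset.∣ S ∣ → 2 * Subset.∣ S ∣ ≤ n →
              #cut r S j₀ * (n C Subset.∣ S ∣) * (M * M) ≤ (⟦ suc Subset.∣ S ∣ ≤? 16 ⟧ * (K₁ * M) + K₂) * T
  rare-cuts S j₀ j₀≤2 4≤s 2s≤n = go (s ℕ/.% 4) (s ℕ/./ 4) (≤-pred (ℕ/.m%n<n s 4)) (trans (ℕ/.m≡m%n+[m/n]*n s 4)
      (trans (+-comm (s ℕ/.% 4) _) (cong (_+ s ℕ/.% 4) (*-comm (s ℕ/./ 4) 4))))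
    where
    open ≤-Reasoning
    s = Subset.∣ S ∣
    go : ∀ m h → m ≤ 3 → s ≡ 4 * h + m →
         #cut r S j₀ * (n C s) * (M * M) ≤ (⟦ suc s ≤? 16 ⟧ * (K₁ * M) + K₂) * T
    go m zero m≤3 eq = contradiction (≤-trans 4≤s (≤-trans (≤-reflexive eq) m≤3)) λ { (s≤s (s≤s (s≤s ()))) }
    go m (suc h) m≤3 eq with h ≤? 2
    ... | yes h≤2 = begin
      #cut r S j₀ * (n C s) * (M * M)
        ≡⟨ cong (λ s → #cut r S j₀ * (n C s) * (M * M)) eq ⟩
      #cut r S j₀ * (n C (4 * suc h + m)) * (M * M)
        ≤⟨ Size.rare-few S h m m≤3 (trans (sym (∣∣≡∑χ S)) eq) (subst (λ s → 2 * s ≤ n) eq 2s≤n) j₀ j₀≤2 h≤2 ⟩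
      K₁ * M * T
        ≤⟨ *-monoˡ-≤ T (≤-trans (≤-reflexive (trans (sym (*-identityˡ (K₁ * M))) (cong (_* (K₁ * M)) (sym
             (⟦⟧-yes (suc s ≤? 16) (s≤s (≤-trans (≤-reflexive eq) (+-mono-≤ (*-monoʳ-≤ 4 (s≤s h≤2)) m≤3))))))))
             (m≤m+n _ K₂)) ⟩
      (⟦ suc s ≤? 16 ⟧ * (K₁ * M) + K₂) * T ∎
    ... | no h≰2 = begin
      #cut r S j₀ * (n C s) * (M * M)
        ≡⟨ cong (λ s → #cut r S j₀ * (n C s) * (M * M)) eq ⟩
      #cut r S j₀ * (n C (4 * suc h + m)) * (M * M)
        ≤⟨ Size.rare-many S h m m≤3 (trans (sym (∣∣≡∑χ S)) eq) (subst (λ s → 2 * s ≤ n) eq 2s≤n) j₀ j₀≤2 (≰⇒> h≰2) ⟩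
      K₂ * T
        ≤⟨ *-monoˡ-≤ T (m≤n+m K₂ (⟦ suc s ≤? 16 ⟧ * (K₁ * M))) ⟩
      (⟦ suc s ≤? 16 ⟧ * (K₁ * M) + K₂) * T ∎

-- Union bound over all vertex sets

#subsets≤ : ∀ n s → ∑[ S ∈ subsets n ] ⟦ Subset.∣ S ∣ ≟ s ⟧ ≤ n C s
#subsets≤ zero    zero    = ≤-refl
#subsets≤ zero    (suc s) = z≤n
#subsets≤ (suc n) s = ≤-trans (≤-reflexive (trans (∑-++ (map (false ∷_) (subsets n)) _ _)
    (cong₂ _+_ (∑-map (false ∷_) (subsets n) _) (trans (∑-++ (map (true ∷_) (subsets n)) [] _)
      (trans (+-identityʳ _) (∑-map (true ∷_) (subsets n) _))))))
  (split s)
  where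
  split : ∀ s → (∑[ S ∈ subsets n ] ⟦ Subset.∣ S ∣ ≟ s ⟧) + (∑[ S ∈ subsets n ] ⟦ suc Subset.∣ S ∣ ≟ s ⟧) ≤ suc n C s
  split zero    = ≤-trans (+-mono-≤ (#subsets≤ n 0) (≤-reflexive (∑-zero (subsets n))))
    (≤-reflexive (trans (+-identityʳ _) (trans (nC0≡1 n) (sym (nC0≡1 (suc n))))))
  split (suc s) = ≤-trans (+-mono-≤ (#subsets≤ n (suc s)) (#subsets≤ n s))
    (≤-reflexive (trans (+-comm (n C suc s) _) (sym (pascal n s))))

1≤C : ∀ {n k} → k ≤ n → 1 ≤ n C k
1≤C {n} {k} k≤n with m≤n⇒∃[o]m+o≡n k≤n
... | o , refl = ≤-trans (≤-reflexive (sym (cong₂ _*_ (nCn≡1 k) (nC0≡1 o))))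
  (≤-trans (C-*-≤ k o k 0) (≤-reflexive (cong ((k + o) C_) (+-identityʳ k))))

∑-downFrom-< : ∀ n c → ∑[ s ∈ downFrom n ] ⟦ suc s ≤? c ⟧ ≤ c
∑-downFrom-< zero    c = z≤n
∑-downFrom-< (suc n) c = go (suc n ≤? c)
  where
  go : Dec (suc n ≤ c) → ∑[ s ∈ downFrom (suc n) ] ⟦ suc s ≤? c ⟧ ≤ c
  go (yes le) = ≤-trans (∑-mono (downFrom (suc n)) λ s → 𝟙≤1 (does (suc s ≤? c)))
    (≤-trans (≤-reflexive (trans (∑-const (downFrom (suc n)) 1) (trans (*-identityʳ _) (length-downFrom (suc n))))) le)
  go (no ¬le) = ≤-trans (≤-reflexive (cong (_+ ∑ (downFrom n) (λ s → ⟦ suc s ≤? c ⟧)) (⟦⟧-no (suc n ≤? c) ¬le))) (∑-downFrom-< n c)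

SparseCut : ∀ {n} → Graph n → Set
SparseCut {n} G = ∃ λ S → 4 ≤ Subset.∣ S ∣ × 2 * Subset.∣ S ∣ ≤ n × cut S G ≤ 2

-- Three values 0, 1, 2 of the cut; at most 16 sizes below 16 contribute `K₁ * M` each, and the
-- `n + 1 ≤ 230 * M` sizes contribute `K₂` each.
K : ℕ
K = 3 * (16 * K₁ + 230 * K₂)

module _ {n r M : ℕ} (3≤r : 3 ≤ r) (R≤M : r * r ≤ M) (5≤M : 5 ≤ M)
  (160M≤n : 160 * M ≤ n) (n≤160M : n ≤ 160 * M + 160) where

  private
    T = #regular r n

    bound : ℕ → ℕ
    bound s = (⟦ suc s ≤? 16 ⟧ * (K₁ * M) + K₂) * T

    low : Subset n → Graph n → ℕ
    low S G = class r S 0 G + class r S 1 G + class r S 2 G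

    #low : Subset n → ℕ
    #low S = ∑[ G ∈ graphs n ] low S G

    #low-bound : ∀ S → 4 ≤ Subset.∣ S ∣ → 2 * Subset.∣ S ∣ ≤ n →
                 #low S * ((n C Subset.∣ S ∣) * (M * M)) ≤ 3 * bound Subset.∣ S ∣
    #low-bound S 4≤s 2s≤n = begin
      #low S * D
        ≡⟨ cong (_* D) (trans (∑-+ (graphs n) (λ G → class r S 0 G + class r S 1 G) (class r S 2))
             (cong (_+ #cut r S 2) (∑-+ (graphs n) (class r S 0) (class r S 1)))) ⟩
      (#cut r S 0 + #cut r S 1 + #cut r S 2) * D
        ≡⟨ trans (*-distribʳ-+ D (#cut r S 0 + #cut r S 1) _) (cong (_+ #cut r S 2 * D) (*-distribʳ-+ D (#cut r S 0) _)) ⟩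
      #cut r S 0 * D + #cut r S 1 * D + #cut r S 2 * D
        ≤⟨ +-mono-≤ (+-mono-≤ (rare 0 z≤n) (rare 1 (s≤s z≤n))) (rare 2 ≤-refl) ⟩
      bound s + bound s + bound s
        ≡⟨ solve 1 (λ b → b :+ b :+ b := con 3 :* b) refl (bound s) ⟩
      3 * bound s ∎
      where
      open ≤-Reasoning
      s = Subset.∣ S ∣
      D = (n C s) * (M * M)
      rare : ∀ j₀ → j₀ ≤ 2 → #cut r S j₀ * D ≤ bound s
      rare j₀ j₀≤2 = ≤-trans (≤-reflexive (sym (*-assoc (#cut r S j₀) _ _))) (rare-cuts 3≤r R≤M 5≤M 160M≤n n≤160M S j₀ j₀≤2 4≤s 2s≤n)

    level : ℕ → ℕ
    level s = ∑[ S ∈ subsets n ] ⟦ Subset.∣ S ∣ ≟ s ⟧ * #low S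

    -- `level s` counts the pairs of a set of size `s` and a regular graph with at most two edges
    -- across it. The number of sets is at most `n C s`, which cancels the same factor in
    -- `#low-bound`.
    level-bound : ∀ s → 4 ≤ s → 2 * s ≤ n → level s * (M * M) ≤ 3 * bound s
    level-bound s 4≤s 2s≤n = *-cancelˡ-≤ (n C s) {{>-nonZero (1≤C (≤-trans (m≤m+n s _) 2s≤n))}} (begin
      (n C s) * (level s * (M * M))
        ≡⟨ solve 3 (λ c l m → c :* (l :* m) := l :* (c :* m)) refl (n C s) (level s) (M * M) ⟩
      level s * D
        ≡⟨ ∑-*ʳ (subsets n) (λ S → ⟦ Subset.∣ S ∣ ≟ s ⟧ * #low S) D ⟨
      (∑[ S ∈ subsets n ] ⟦ Subset.∣ S ∣ ≟ s ⟧ * #low S * D)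
        ≤⟨ ∑-mono (subsets n) (λ S → each S (Subset.∣ S ∣ ≟ s)) ⟩
      (∑[ S ∈ subsets n ] ⟦ Subset.∣ S ∣ ≟ s ⟧ * (3 * bound s))
        ≡⟨ ∑-*ʳ (subsets n) (λ S → ⟦ Subset.∣ S ∣ ≟ s ⟧) (3 * bound s) ⟩
      (∑[ S ∈ subsets n ] ⟦ Subset.∣ S ∣ ≟ s ⟧) * (3 * bound s)
        ≤⟨ *-monoˡ-≤ (3 * bound s) (#subsets≤ n s) ⟩
      (n C s) * (3 * bound s) ∎)
      where
      open ≤-Reasoning
      D = (n C s) * (M * M)
      each : ∀ S (eq : Dec (Subset.∣ S ∣ ≡ s)) → ⟦ eq ⟧ * #low S * D ≤ ⟦ eq ⟧ * (3 * bound s)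
      each S (no _)     = z≤n
      each S (yes refl) = ≤-trans (≤-reflexive (cong (_* D) (*-identityˡ (#low S))))
        (≤-trans (#low-bound S 4≤s 2s≤n) (m≤m+n _ 0))

    admissible : ℕ → ℕ
    admissible s = ⟦ 4 ≤? s ⟧ * ⟦ 2 * s ≤? n ⟧

    level-sum : (∑[ s ∈ downFrom (suc n) ] admissible s * level s) * (M * M) ≤ K * T * M
    level-sum = begin
      (∑[ s ∈ downFrom (suc n) ] admissible s * level s) * (M * M)
        ≡⟨ ∑-*ʳ (downFrom (suc n)) (λ s → admissible s * level s) (M * M) ⟨
      (∑[ s ∈ downFrom (suc n) ] admissible s * level s * (M * M))
        ≤⟨ ∑-mono (downFrom (suc n)) (λ s → each s (4 ≤? s) (2 * s ≤? n)) ⟩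
      (∑[ s ∈ downFrom (suc n) ] 3 * bound s)
        ≡⟨ trans (∑-*ˡ (downFrom (suc n)) 3 bound) (cong (3 *_) (trans (∑-*ʳ (downFrom (suc n)) (λ s → ⟦ suc s ≤? 16 ⟧ * (K₁ * M) + K₂) T)
             (cong (_* T) (trans (∑-+ (downFrom (suc n)) (λ s → ⟦ suc s ≤? 16 ⟧ * (K₁ * M)) (λ _ → K₂))
               (cong₂ _+_ (∑-*ʳ (downFrom (suc n)) (λ s → ⟦ suc s ≤? 16 ⟧) (K₁ * M))
                  (trans (∑-const (downFrom (suc n)) K₂) (cong (_* K₂) (length-downFrom (suc n))))))))) ⟩
      3 * (((∑[ s ∈ downFrom (suc n) ] ⟦ suc s ≤? 16 ⟧) * (K₁ * M) + suc n * K₂) * T)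
        ≤⟨ *-monoʳ-≤ 3 (*-monoˡ-≤ T (+-mono-≤ (*-monoˡ-≤ (K₁ * M) (∑-downFrom-< (suc n) 16)) (*-monoˡ-≤ K₂ n<))) ⟩
      3 * ((16 * (K₁ * M) + 230 * M * K₂) * T)
        ≡⟨ solve 4 (λ K₁ K₂ M T → con 3 :* ((con 16 :* (K₁ :* M) :+ con 230 :* M :* K₂) :* T) :=
             con 3 :* (con 16 :* K₁ :+ con 230 :* K₂) :* T :* M) refl K₁ K₂ M T ⟩
      K * T * M ∎
      where
      open ≤-Reasoning
      n< : suc n ≤ 230 * M
      n< = begin
        1 + n               ≤⟨ +-monoʳ-≤ 1 n≤160M ⟩
        1 + (160 * M + 160) ≡⟨ solve 1 (λ m → con 1 :+ (m :+ con 160) := m :+ con 161) refl (160 * M) ⟩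
        160 * M + 161       ≤⟨ +-monoʳ-≤ (160 * M) (≤-trans (≤-by 189 refl) (*-monoʳ-≤ 70 5≤M)) ⟩
        160 * M + 70 * M    ≡⟨ solve 1 (λ M → con 160 :* M :+ con 70 :* M := con 230 :* M) refl M ⟩
        230 * M             ∎
      each : ∀ s (p : Dec (4 ≤ s)) (q : Dec (2 * s ≤ n)) → ⟦ p ⟧ * ⟦ q ⟧ * level s * (M * M) ≤ 3 * bound s
      each s (no _)    _          = z≤n
      each s (yes _)   (no _)     = z≤n
      each s (yes 4≤s) (yes 2s≤n) = ≤-trans (≤-reflexive (cong (_* (M * M)) (*-identityˡ (level s)))) (level-bound s 4≤s 2s≤n)

    module _ (G : Graph n) (reg : Regular r G) where

      low-positive : ∀ S → cut S G ≤ 2 → 1 ≤ low S G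
      low-positive S cut≤2 = go (cut S G) refl cut≤2
        where
        c = λ j → class r S j G
        one : ∀ j → cut S G ≡ j → 1 ≤ class r S j G
        one j eq = ≤-reflexive (sym (cong₂ _*_ (⟦⟧-yes (regular? r G) reg) (⟦⟧-yes (cut S G ≟ j) eq)))
        go : ∀ j → cut S G ≡ j → j ≤ 2 → 1 ≤ low S G
        go 0 eq _ = ≤-trans (one 0 eq) (≤-trans (m≤m+n (c 0) (c 1)) (m≤m+n (c 0 + c 1) (c 2)))
        go 1 eq _ = ≤-trans (one 1 eq) (≤-trans (m≤n+m (c 1) (c 0)) (m≤m+n (c 0 + c 1) (c 2)))
        go 2 eq _ = ≤-trans (one 2 eq) (m≤n+m (c 2) (c 0 + c 1))
        go (suc (suc (suc _))) _ (s≤s (s≤s ()))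

      detect : SparseCut G → 1 ≤ ∑[ s ∈ downFrom (suc n) ] admissible s * (∑[ S ∈ subsets n ] ⟦ Subset.∣ S ∣ ≟ s ⟧ * low S G)
      detect (S , 4≤s , 2s≤n , cut≤2) = ≤-trans
        (*-mono-≤ {1} {_} {1} (≤-reflexive (sym (cong₂ _*_ (⟦⟧-yes (4 ≤? s) 4≤s) (⟦⟧-yes (2 * s ≤? n) 2s≤n))))
          (≤-trans (*-mono-≤ {1} {_} {1} (≤-reflexive (sym (⟦⟧-yes (s ≟ s) refl))) (low-positive S cut≤2))
            (term≤∑ (λ S → ⟦ Subset.∣ S ∣ ≟ s ⟧ * low S G) (∈-subsets S))))
        (term≤∑ (λ s → admissible s * (∑[ S ∈ subsets n ] ⟦ Subset.∣ S ∣ ≟ s ⟧ * low S G)) (∈-downFrom⁺ (s≤s (≤-trans (m≤m+n s _) 2s≤n))))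
        where s = Subset.∣ S ∣

  sparse-cuts-rare : {P : Pred (Graph n) 0ℓ} (P? : Decidable P) → (∀ G → P G → Regular r G × SparseCut G) →
                     #graphs n P? * M ≤ K * T
  sparse-cuts-rare P? sparse = *-cancelʳ-≤ _ _ M {{>-nonZero (≤-trans (s≤s z≤n) 5≤M)}} (begin
    #graphs n P? * M * M
      ≡⟨ trans (*-assoc (#graphs n P?) M M) (cong (_* (M * M)) (length-filter≡∑ P? (graphs n))) ⟩
    (∑[ G ∈ graphs n ] ⟦ P? G ⟧) * (M * M)
      ≤⟨ *-monoˡ-≤ (M * M) (∑-mono (graphs n) λ G → ⟦⟧-intro (P? G) λ p → detect G (proj₁ (sparse G p)) (proj₂ (sparse G p))) ⟩
    (∑[ G ∈ graphs n ] ∑[ s ∈ range ] admissible s * (∑[ S ∈ subsets n ] ⟦ Subset.∣ S ∣ ≟ s ⟧ * low S G)) * (M * M)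
      ≡⟨ cong (_* (M * M)) (trans (∑-swap (graphs n) range _) (∑-cong range λ s → trans (∑-*ˡ (graphs n) (admissible s) _)
           (cong (admissible s *_) (trans (∑-swap (graphs n) (subsets n) _) (∑-cong (subsets n) λ S → ∑-*ˡ (graphs n) ⟦ Subset.∣ S ∣ ≟ s ⟧ (low S)))))) ⟩
    (∑[ s ∈ range ] admissible s * level s) * (M * M)
      ≤⟨ level-sum ⟩
    K * T * M ∎)
    where
    open ≤-Reasoning
    range = downFrom (suc n)

-- Strongly connected orientations (Robbins' theorem)

Arcs : ℕ → Set
Arcs n = Fin n → Fin n → Bool

Leaves : ∀ {n} → Arcs n → Subset n → Fin n → Fin n → Set
Leaves O S x y = x ∈ S × y ∉ S × O x y ≡ true

Nontrivial : ∀ {n} → Subset n → Set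
Nontrivial S = ∃ (_∈ S) × ∃ (_∉ S)

-- By StronglyConnected⇒Star this says that every vertex can be reached from every other one.
StronglyConnected : ∀ {n} → Arcs n → Set
StronglyConnected O = ∀ S → Nontrivial S → ∃ λ x → ∃ λ y → Leaves O S x y

-- For symmetric `B`: no cut consists of at most one edge. An edge across the cut has just one
-- direction that leaves `S`, so excluding the arc from `u` to `v` excludes one edge.
Bridgeless : ∀ {n} → Arcs n → Set
Bridgeless B = ∀ S → Nontrivial S → ∀ u v → ∃ λ x → ∃ λ y → Leaves B S x y × ¬ (x ≡ u × y ≡ v)

leaves? : ∀ {n} (O : Arcs n) S → Dec (∃ λ x → ∃ λ y → Leaves O S x y)
leaves? O S = Fin.any? λ x → Fin.any? λ y → (x ∈? S) ×-dec ¬? (y ∈? S) ×-dec (O x y Bool.≟ true)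

stronglyConnected-or-closed : ∀ {n} (O : Arcs n) →
  StronglyConnected O ⊎ ∃ λ S → Nontrivial S × ¬ (∃ λ x → ∃ λ y → Leaves O S x y)
stronglyConnected-or-closed O with anySubset? (λ S →
  (Fin.any? (_∈? S) ×-dec Fin.any? (λ x → ¬? (x ∈? S))) ×-dec ¬? (leaves? O S))
... | yes closed = inj₂ closed
... | no ¬closed = inj₁ strong
  where
  strong : StronglyConnected O
  strong S nt with leaves? O S
  ... | yes l = l
  ... | no ¬l = ⊥-elim (¬closed (S , nt , ¬l))

remove : ∀ {n} → Fin n → Fin n → Arcs n → Arcs n
remove u v O x y = O x y ∧ not (δᵇ x u ∧ δᵇ y v)

remove-⊆ : ∀ {n} (u v : Fin n) O {x y} → remove u v O x y ≡ true → O x y ≡ true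
remove-⊆ u v O {x} {y} p with O x y
... | true = refl

remove-≢ : ∀ {n} (u v : Fin n) O {x y} → O x y ≡ true → ¬ (x ≡ u × y ≡ v) → remove u v O x y ≡ true
remove-≢ u v O {x} {y} o ne with x Fin.≟ u | y Fin.≟ v
... | yes p | yes q = ⊥-elim (ne (p , q))
... | yes _ | no _  = trans (Bool.∧-identityʳ _) o
... | no _  | _     = trans (Bool.∧-identityʳ _) o

remove-removes : ∀ {n} (u v : Fin n) O → remove u v O u v ≡ false
remove-removes u v O with u Fin.≟ u | v Fin.≟ v
... | yes _ | yes _ = Bool.∧-zeroʳ _
... | no ne | _     = ⊥-elim (ne refl)
... | yes _ | no ne = ⊥-elim (ne refl)

module _ {n} (B : Arcs n) (irreflexive : ∀ u → B u u ≡ false) (bridgeless : Bridgeless B) where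

  -- An intermediate stage of Robbins' theorem: every edge of `B` is present in at least one
  -- direction, and the pairs already treated are present in at most one. Starting from both
  -- directions everywhere, strong connectivity is an invariant instead of something to be built up.
  record PartialOrientation (pairs : List (Fin n × Fin n)) : Set where
    field
      arcs     : Arcs n
      arcs⊆B   : ∀ {x y} → arcs x y ≡ true → B x y ≡ true
      covering : ∀ {x y} → B x y ≡ true → arcs x y ≡ true ⊎ arcs y x ≡ true
      strong   : StronglyConnected arcs
      one-way  : ∀ {x y} → (x , y) List.∈ pairs → ¬ (arcs x y ≡ true × arcs y x ≡ true)

  module _ (O : Arcs n) (covering : ∀ {x y} → B x y ≡ true → O x y ≡ true ⊎ O y x ≡ true)
           (strong : StronglyConnected O) where

    private
      only-arc : ∀ {u v S} → Nontrivial S → ¬ (∃ λ x → ∃ λ y → Leaves (remove u v O) S x y) →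
                 ∀ {x y} → Leaves O S x y → x ≡ u × y ≡ v
      only-arc {u} {v} nt closed {x} {y} (x∈ , y∉ , xy) with x Fin.≟ u | y Fin.≟ v
      ... | yes p | yes q = p , q
      ... | yes _ | no ne = ⊥-elim (closed (x , y , x∈ , y∉ , remove-≢ u v O xy (ne ∘ proj₂)))
      ... | no ne | _     = ⊥-elim (closed (x , y , x∈ , y∉ , remove-≢ u v O xy (ne ∘ proj₁)))

    -- If neither direction of uv can be removed, then u → v and v → u are the only arcs out of
    -- sets S and T.  No arc leaves S ∩ T or S ∪ T, so T is the complement of S and uv is a bridge.
    removable : ∀ u v → StronglyConnected (remove u v O) ⊎ StronglyConnected (remove v u O)
    removable u v with stronglyConnected-or-closed (remove u v O)
    ... | inj₁ s = inj₁ s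
    ... | inj₂ (S , ntS , closedS) with stronglyConnected-or-closed (remove v u O)
    ...   | inj₁ s = inj₂ s
    ...   | inj₂ (T , ntT , closedT) = ⊥-elim bridge
      where
      fromS : ∀ {x y} → Leaves O S x y → x ≡ u × y ≡ v
      fromS = only-arc ntS closedS

      fromT : ∀ {x y} → Leaves O T x y → x ≡ v × y ≡ u
      fromT = only-arc ntT closedT

      u∈S,v∉S : u ∈ S × v ∉ S
      u∈S,v∉S with strong S ntS
      ... | x , y , l@(x∈ , y∉ , _) with fromS l
      ...   | refl , refl = x∈ , y∉

      v∈T,u∉T : v ∈ T × u ∉ T
      v∈T,u∉T with strong T ntT
      ... | x , y , l@(x∈ , y∉ , _) with fromT l
      ...   | refl , refl = x∈ , y∉

      -- An arc out of `S ∩ T` leaves `S` or `T`. In the first case its tail is `u`, which is not in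
      -- `T`; in the second it is `v`, which is not in `S`.
      disjoint : ∀ {z} → z ∈ S → z ∉ T
      disjoint {z} z∈S z∈T with strong (S ∩ T) ((z , x∈p∩q⁺ (z∈S , z∈T)) , u , proj₂ v∈T,u∉T ∘ proj₂ ∘ x∈p∩q⁻ S T)
      ... | x , y , x∈ , y∉ , xy with x∈p∩q⁻ S T x∈ | y ∈? S
      ...   | x∈S , x∈T | no y∉S with fromS (x∈S , y∉S , xy)
      ...     | refl , _ = proj₂ v∈T,u∉T x∈T
      disjoint {z} z∈S z∈T | x , y , x∈ , y∉ , xy | x∈S , x∈T | yes y∈S with fromT (x∈T , (λ y∈T → y∉ (x∈p∩q⁺ (y∈S , y∈T))) , xy)
      ...     | refl , _ = proj₂ u∈S,v∉S x∈S

      -- Dually, an arc out of `S ∪ T` leaves `S` or `T`, so its head is `v`, which is in `T`, or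
      -- `u`, which is in `S`.
      exhaustive : ∀ {z} → z ∉ S → z ∈ T
      exhaustive {z} z∉S with z ∈? T
      ... | yes z∈T = z∈T
      ... | no z∉T with strong (S ∪ T) ((u , p⊆p∪q T (proj₁ u∈S,v∉S)) , z , λ z∈ → case x∈p∪q⁻ S T z∈ of λ { (inj₁ p) → z∉S p ; (inj₂ q) → z∉T q })
      ...   | x , y , x∈ , y∉ , xy with x∈p∪q⁻ S T x∈
      ...     | inj₁ x∈S with fromS (x∈S , y∉ ∘ p⊆p∪q T , xy)
      ...       | _ , refl = ⊥-elim (y∉ (q⊆p∪q S T (proj₁ v∈T,u∉T)))
      exhaustive {z} z∉S | no z∉T | x , y , x∈ , y∉ , xy | inj₂ x∈T with fromT (x∈T , y∉ ∘ q⊆p∪q S T , xy)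
      ...       | _ , refl = ⊥-elim (y∉ (p⊆p∪q T (proj₁ u∈S,v∉S)))

      bridge : ⊥
      bridge with bridgeless S ntS u v
      ... | x , y , (x∈S , y∉S , xy) , ne with covering xy
      ...   | inj₁ o = ne (fromS (x∈S , y∉S , o))
      ...   | inj₂ o with fromT (exhaustive y∉S , disjoint x∈S , o)
      ...     | refl , refl = ne (refl , refl)

  orient : (∀ {x y} → B x y ≡ true → B y x ≡ true) → ∀ pairs → PartialOrientation pairs
  orient B-sym [] = record
    { arcs     = B
    ; arcs⊆B   = id
    ; covering = inj₁
    ; strong   = λ S nt → let x , y , l , _ = bridgeless S nt (proj₁ (proj₁ nt)) (proj₁ (proj₁ nt)) in x , y , l
    ; one-way  = λ ()
    }
  orient B-sym ((u , v) ∷ ps) with orient B-sym ps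
  ... | P with PartialOrientation.arcs P u v in uv | PartialOrientation.arcs P v u in vu
  ...   | false | _ = record
    { PartialOrientation P
    ; one-way = λ { (here refl) (p , _) → case trans (sym p) uv of λ () ; (there i) → PartialOrientation.one-way P i } }
  ...   | true | false = record
    { PartialOrientation P
    ; one-way = λ { (here refl) (_ , p) → case trans (sym p) vu of λ () ; (there i) → PartialOrientation.one-way P i } }
  ...   | true | true = case removable arcs covering strong u v of λ where
      (inj₁ s) → drop u v uv vu s λ { (p , _) → case trans (sym p) (remove-removes u v arcs) of λ () }
      (inj₂ s) → drop v u vu uv s λ { (_ , p) → case trans (sym p) (remove-removes v u arcs) of λ () }
    where
    open PartialOrientation P
    drop : ∀ a b → arcs a b ≡ true → arcs b a ≡ true → StronglyConnected (remove a b arcs) →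
           ¬ (remove a b arcs u v ≡ true × remove a b arcs v u ≡ true) → PartialOrientation ((u , v) ∷ ps)
    drop a b ab ba s ow = record
      { arcs     = remove a b arcs
      ; arcs⊆B   = arcs⊆B ∘ remove-⊆ a b arcs
      ; covering = cov
      ; strong   = s
      ; one-way  = λ { (here refl) → ow
                     ; (there i) (p , q) → one-way i (remove-⊆ a b arcs p , remove-⊆ a b arcs q) }
      }
      where
      a≢b : a ≢ b
      a≢b refl = case trans (sym (arcs⊆B ab)) (irreflexive a) of λ ()
      keep : ∀ {x y} → arcs x y ≡ true → remove a b arcs x y ≡ true ⊎ (x ≡ a × y ≡ b)
      keep {x} {y} xy with x Fin.≟ a | y Fin.≟ b
      ... | yes p | yes q = inj₂ (p , q)
      ... | yes _ | no ne = inj₁ (trans (Bool.∧-identityʳ _) xy)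
      ... | no ne | _     = inj₁ (trans (Bool.∧-identityʳ _) xy)
      cov : ∀ {x y} → B x y ≡ true → remove a b arcs x y ≡ true ⊎ remove a b arcs y x ≡ true
      cov xy with covering xy
      ... | inj₁ o with keep o
      ...   | inj₁ o′            = inj₁ o′
      ...   | inj₂ (refl , refl) = inj₂ (remove-≢ a b arcs ba (≢-sym a≢b ∘ proj₁))
      cov xy | inj₂ o with keep o
      ...   | inj₁ o′            = inj₂ o′
      ...   | inj₂ (refl , refl) = inj₁ (remove-≢ a b arcs ba (≢-sym a≢b ∘ proj₁))

Arc : ∀ {n} → Arcs n → Fin n → Fin n → Set
Arc O x y = O x y ≡ true

-- A set of vertices reached from `u` that misses `v` is nontrivial, so some arc leaves it and its
-- head can be added; the growth stops by finiteness.
StronglyConnected⇒Star : ∀ {n} {O : Arcs n} → StronglyConnected O → ∀ u v → Star (Arc O) u v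
StronglyConnected⇒Star {n} {O} strong u v =
  grow ⁅ u ⁆ (⊃-wellFounded ⁅ u ⁆) (x∈⁅x⁆ u) λ x∈ → subst (Star (Arc O) u) (sym (x∈⁅y⁆⇒x≡y u x∈)) stay
  where
  grow : ∀ R → Acc _⊃_ R → u ∈ R → (∀ {x} → x ∈ R → Star (Arc O) u x) → Star (Arc O) u v
  grow R (acc rec) u∈R reach with v ∈? R
  ... | yes v∈R = reach v∈R
  ... | no v∉R with strong R ((u , u∈R) , v , v∉R)
  ...   | x , y , x∈R , y∉R , xy =
    grow (R ∪ ⁅ y ⁆) (rec (p⊆p∪q ⁅ y ⁆ , y , q⊆p∪q R ⁅ y ⁆ (x∈⁅x⁆ y) , y∉R)) (p⊆p∪q ⁅ y ⁆ u∈R)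
      λ z∈ → case x∈p∪q⁻ R ⁅ y ⁆ z∈ of λ where
        (inj₁ z∈R) → reach z∈R
        (inj₂ z∈y) → subst (Star (Arc O) u) (sym (x∈⁅y⁆⇒x≡y y z∈y)) (reach x∈R ◅◅ (xy ◅ stay))

-- Three-edge-connectivity in the absence of sparse cuts

χ-∈ : ∀ {n} {S : Subset n} {x} → x ∈ S → χ S x ≡ 1
χ-∈ x∈ = cong 𝟙 ([]=⇒lookup x∈)

lookup-false⇒∉ : ∀ {n} {S : Subset n} {x} → Vec.lookup S x ≡ false → x ∉ S
lookup-false⇒∉ eq x∈ = case trans (sym ([]=⇒lookup x∈)) eq of λ ()

cut-∁ : ∀ {n} (S : Subset n) G → cut (∁ S) G ≡ cut S G
cut-∁ S G = trans (∑²-cong λ u v → cong₂ _*_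
    (trans (cong₂ _*_ (cong 𝟙 (lookup-map u not S)) (cong 𝟙 (trans (cong not (lookup-map v not S)) (Bool.not-involutive _))))
           (*-comm (χ̄ S u) (χ S v)))
    (A-comm G u v))
  (∑²-swap λ u v → boundary S v u * A G v u)

module _ {n r} (G : Graph n) (3≤r : 3 ≤ r) (reg : Regular r G) where

  -- A set of s vertices spans at most s(s − 1) ordered pairs of adjacent vertices.
  small-cut : ∀ S → 1 ≤ Subset.∣ S ∣ → Subset.∣ S ∣ ≤ 3 → 3 ≤ cut S G
  small-cut S 1≤s s≤3 = go s 1≤s s≤3 (≤-trans (*-monoˡ-≤ s (s≤s 3≤r)) count)
    where
    s = Subset.∣ S ∣

    inside-pairs : ∑² (λ a b → χ S a * χ S b * A G a b) + s ≤ s * s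
    inside-pairs = begin
      ∑² (λ a b → χ S a * χ S b * A G a b) + s
        ≡⟨ cong (∑² (λ a b → χ S a * χ S b * A G a b) +_) (trans (∣∣≡∑χ S) (∑-cong (allFin n) λ a → sym (∑-δ (λ _ → χ S a) a))) ⟩
      ∑² (λ a b → χ S a * χ S b * A G a b) + ∑² (λ a b → δ b a * χ S a)
        ≡⟨ ∑²-+ (λ a b → χ S a * χ S b * A G a b) (λ a b → δ b a * χ S a) ⟨
      ∑² (λ a b → χ S a * χ S b * A G a b + δ b a * χ S a)
        ≤⟨ ∑²-mono (λ a b → each a b (b Fin.≟ a)) ⟩
      ∑² (λ a b → χ S a * χ S b)
        ≡⟨ trans (∑-*-∑ (allFin n) (allFin n) (χ S) (χ S)) (sym (cong₂ _*_ (∣∣≡∑χ S) (∣∣≡∑χ S))) ⟩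
      s * s ∎
      where
      open ≤-Reasoning
      each : ∀ a b (d : Dec (b ≡ a)) → χ S a * χ S b * A G a b + ⟦ d ⟧ * χ S a ≤ χ S a * χ S b
      each a b (no _)     = ≤-trans (≤-reflexive (+-identityʳ _))
        (≤-trans (*-monoʳ-≤ (χ S a * χ S b) (𝟙≤1 (adj G a b))) (≤-reflexive (*-identityʳ _)))
      each a _ (yes refl) = ≤-reflexive (trans (cong₂ _+_ (trans (cong (λ z → χ S a * χ S a * 𝟙 z) (adj-diag G a)) (*-zeroʳ (χ S a * χ S a))) (*-identityˡ (χ S a)))
        (square (Vec.lookup S a)))
        where
        square : ∀ b → 𝟙 b ≡ 𝟙 b * 𝟙 b
        square true  = refl
        square false = refl

    count : suc r * s ≤ cut S G + s * s
    count = begin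
      s + r * s
        ≡⟨ cong (s +_) (trans (cong (r *_) (∣∣≡∑χ S)) (sym (degree-sum-inside r S G reg))) ⟩
      s + (∑² (λ a b → χ S a * χ S b * A G a b) + cut S G)
        ≡⟨ solve 3 (λ s i c → s :+ (i :+ c) := c :+ (i :+ s)) refl s _ (cut S G) ⟩
      cut S G + (∑² (λ a b → χ S a * χ S b * A G a b) + s)
        ≤⟨ +-monoʳ-≤ (cut S G) inside-pairs ⟩
      cut S G + s * s ∎
      where open ≤-Reasoning

    -- The value of `4s − s²` is 3, 4, 3 for `s` = 1, 2, 3. At `s = 4` it drops to 0, which is why
    -- sparse cuts are considered from size 4 on.
    go : ∀ s → 1 ≤ s → s ≤ 3 → 4 * s ≤ cut S G + s * s → 3 ≤ cut S G
    go 1 _ _ h = +-cancelʳ-≤ 1 3 _ h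
    go 2 _ _ h = ≤-trans (n≤1+n 3) (+-cancelʳ-≤ 4 4 _ h)
    go 3 _ _ h = +-cancelʳ-≤ 9 3 _ h
    go (suc (suc (suc (suc _)))) _ (s≤s (s≤s (s≤s ()))) _

  three-edge-connected : ¬ SparseCut G → ∀ S → Nontrivial S → 3 ≤ cut S G
  three-edge-connected ¬sparse S ((x , x∈) , y , y∉) = case ≤-total (2 * Subset.∣ S ∣) n of λ
    { (inj₁ 2s≤n) → half S (nonempty x∈) 2s≤n
    ; (inj₂ n≤2s) → ≤-trans (half (∁ S) (nonempty (x∉p⇒x∈∁p y∉)) (≤-trans (≤-reflexive (cong (2 *_) (∣∁p∣≡n∸∣p∣ S))) (complement {n} {Subset.∣ S ∣} n≤2s)))
                          (≤-reflexive (cut-∁ S G)) }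
    where
    nonempty : ∀ {S : Subset n} {x} → x ∈ S → 1 ≤ Subset.∣ S ∣
    nonempty {S} {x} x∈ = ≤-trans (≤-reflexive (sym (χ-∈ x∈))) (≤-trans (term≤∑ (χ S) (∈-allFin x)) (≤-reflexive (sym (∣∣≡∑χ S))))

    half : ∀ S → 1 ≤ Subset.∣ S ∣ → 2 * Subset.∣ S ∣ ≤ n → 3 ≤ cut S G
    half S 1≤s 2s≤n with 4 ≤? Subset.∣ S ∣ | 3 ≤? cut S G
    ... | _       | yes 3≤c = 3≤c
    ... | yes 4≤s | no 3≰c  = ⊥-elim (¬sparse (S , 4≤s , 2s≤n , ≤-pred (≰⇒> 3≰c)))
    ... | no 4≰s  | no _    = small-cut S 1≤s (≤-pred (≰⇒> 4≰s))

    complement : ∀ {n s} → n ≤ 2 * s → 2 * (n ∸ s) ≤ n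
    complement {n} {s} n≤2s = begin
      2 * (n ∸ s)   ≡⟨ *-distribˡ-∸ 2 n s ⟩
      2 * n ∸ 2 * s ≤⟨ ∸-monoʳ-≤ (2 * n) n≤2s ⟩
      2 * n ∸ n     ≡⟨ trans (cong (_∸ n) (cong (n +_) (+-identityʳ n))) (m+n∸n≡m n n) ⟩
      n             ∎
      where open ≤-Reasoning

-- The edges across a maximum cut

module _ {n} (G : Graph n) (tec : ∀ S → Nontrivial S → 3 ≤ cut S G) where

  private
    X : Subset n
    X = argmax (λ S → cut S G) (Vec.replicate n false) (subsets n)

    maximal : ∀ S → cut S G ≤ cut X G
    maximal S = All.lookup (f[xs]≤f[argmax] (Vec.replicate n false) (subsets n)) (∈-subsets S)

  side : Fin n → Bool
  side = Vec.lookup X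

  cross : Arcs n
  cross u v = adj G u v ∧ (side u xor side v)

  cross-comm : ∀ u v → cross u v ≡ cross v u
  cross-comm u v = cong₂ _∧_ (adj-comm G u v) (Bool.xor-comm (side u) (side v))

  private
    -- Unlike `boundary`, this counts every crossing edge in both directions, and it turns symmetric
    -- differences of sets into `xor`. `exchange` is therefore proved pointwise for `diff` and then
    -- halved.
    diff : Subset n → Fin n → Fin n → ℕ
    diff S u v = 𝟙 (Vec.lookup S u xor Vec.lookup S v)

    ∑-diff : ∀ S (w : Fin n → Fin n → ℕ) → (∀ u v → w u v ≡ w v u) →
             ∑² (λ u v → diff S u v * w u v) ≡ 2 * ∑² (λ u v → boundary S u v * w u v)
    ∑-diff S w w-sym = trans (∑²-cong λ u v → trans (cong (_* w u v) (xor-split (Vec.lookup S u) (Vec.lookup S v)))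
        (trans (*-distribʳ-+ (w u v) (boundary S u v) _) (cong (λ z → boundary S u v * w u v + boundary S v u * z) (w-sym u v))))
      (trans (∑²-+ (λ u v → boundary S u v * w u v) (λ u v → boundary S v u * w v u))
        (cong (∑² (λ u v → boundary S u v * w u v) +_)
          (trans (sym (∑²-swap λ u v → boundary S u v * w u v)) (sym (+-identityʳ _)))))
      where
      xor-split : ∀ a b → 𝟙 (a xor b) ≡ 𝟙 a * 𝟙 (not b) + 𝟙 b * 𝟙 (not a)
      xor-split true  true  = refl
      xor-split true  false = refl
      xor-split false true  = refl
      xor-split false false = refl

    crossings : Subset n → ℕ
    crossings S = ∑² λ u v → boundary S u v * 𝟙 (cross u v)

    -- Comparing X with the symmetric difference of X and S.
    exchange : ∀ S → cut (Vec.zipWith _xor_ X S) G + 2 * crossings S ≡ cut X G + cut S G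
    exchange S = *-cancelˡ-≡ _ _ 2 (begin
      2 * (cut (Vec.zipWith _xor_ X S) G + 2 * crossings S)
        ≡⟨ solve 2 (λ a b → con 2 :* (a :+ con 2 :* b) := con 2 :* a :+ con 2 :* (con 2 :* b)) refl (cut (Vec.zipWith _xor_ X S) G) (crossings S) ⟩
      2 * cut (Vec.zipWith _xor_ X S) G + 2 * (2 * crossings S)
        ≡⟨ cong₂ (λ a b → a + 2 * b) (∑-diff (Vec.zipWith _xor_ X S) (A G) (A-comm G)) (∑-diff S (λ u v → 𝟙 (cross u v)) (λ u v → cong 𝟙 (cross-comm u v))) ⟨
      ∑² (λ u v → diff (Vec.zipWith _xor_ X S) u v * A G u v) + 2 * ∑² (λ u v → diff S u v * 𝟙 (cross u v))
        ≡⟨ cong (∑² (λ u v → diff (Vec.zipWith _xor_ X S) u v * A G u v) +_) (∑²-*ˡ 2 (λ u v → diff S u v * 𝟙 (cross u v))) ⟨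
      ∑² (λ u v → diff (Vec.zipWith _xor_ X S) u v * A G u v) + ∑² (λ u v → 2 * (diff S u v * 𝟙 (cross u v)))
        ≡⟨ ∑²-+ (λ u v → diff (Vec.zipWith _xor_ X S) u v * A G u v) (λ u v → 2 * (diff S u v * 𝟙 (cross u v))) ⟨
      ∑² (λ u v → diff (Vec.zipWith _xor_ X S) u v * A G u v + 2 * (diff S u v * 𝟙 (cross u v)))
        ≡⟨ ∑²-cong (λ u v → trans (cong (λ b → 𝟙 b * A G u v + 2 * (diff S u v * 𝟙 (cross u v)))
                                     (cong₂ _xor_ (lookup-zipWith _xor_ u X S) (lookup-zipWith _xor_ v X S)))
             (pointwise (side u) (Vec.lookup S u) (side v) (Vec.lookup S v) (adj G u v))) ⟩
      ∑² (λ u v → diff X u v * A G u v + diff S u v * A G u v)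
        ≡⟨ ∑²-+ (λ u v → diff X u v * A G u v) (λ u v → diff S u v * A G u v) ⟩
      ∑² (λ u v → diff X u v * A G u v) + ∑² (λ u v → diff S u v * A G u v)
        ≡⟨ cong₂ _+_ (∑-diff X (A G) (A-comm G)) (∑-diff S (A G) (A-comm G)) ⟩
      2 * cut X G + 2 * cut S G
        ≡⟨ *-distribˡ-+ 2 (cut X G) (cut S G) ⟨
      2 * (cut X G + cut S G) ∎)
      where
      open ≡-Reasoning
      -- For `d = x xor y` and `e = s xor t` this is the identity
      -- `𝟙 (d xor e) + 2 * 𝟙 (d ∧ e) ≡ 𝟙 d + 𝟙 e`, multiplied by the bit `a`.
      pointwise : ∀ x s y t a → 𝟙 ((x xor s) xor (y xor t)) * 𝟙 a + 2 * (𝟙 (s xor t) * 𝟙 (a ∧ (x xor y))) ≡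
                                𝟙 (x xor y) * 𝟙 a + 𝟙 (s xor t) * 𝟙 a
      pointwise true  true  true  true  true  = refl
      pointwise true  true  true  false true  = refl
      pointwise true  true  false true  true  = refl
      pointwise true  true  false false true  = refl
      pointwise true  false true  true  true  = refl
      pointwise true  false true  false true  = refl
      pointwise true  false false true  true  = refl
      pointwise true  false false false true  = refl
      pointwise false true  true  true  true  = refl
      pointwise false true  true  false true  = refl
      pointwise false true  false true  true  = refl
      pointwise false true  false false true  = refl
      pointwise false false true  true  true  = refl
      pointwise false false true  false true  = refl
      pointwise false false false true  true  = refl
      pointwise false false false false true  = refl
      pointwise x s y t false rewrite *-zeroʳ (𝟙 ((x xor s) xor (y xor t))) | *-zeroʳ (𝟙 (s xor t)) | *-zeroʳ (𝟙 (x xor y)) = refl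

    -- Maximality of `X` in `exchange` gives `cut S G ≤ 2 * crossings S`; since the left side is at
    -- least 3, one crossing edge is too few.
    2≤crossings : ∀ S → Nontrivial S → 2 ≤ crossings S
    2≤crossings S nt with 2 ≤? crossings S
    ... | yes 2≤c = 2≤c
    ... | no 2≰c = contradiction
      (≤-trans (tec S nt) (≤-trans (+-cancelˡ-≤ (cut X G) _ _ (≤-trans (≤-reflexive (sym (exchange S)))
        (+-monoˡ-≤ (2 * crossings S) (maximal (Vec.zipWith _xor_ X S))))) (*-monoʳ-≤ 2 (≤-pred (≰⇒> 2≰c)))))
      λ { (s≤s (s≤s ())) }

  -- If every arc of `cross` out of `S` were the one from `u` to `v`, then `crossings S` would be at
  -- most 1.
  cross-bridgeless : Bridgeless cross
  cross-bridgeless S nt u v with Fin.any? (λ x → Fin.any? λ y →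
    ((x ∈? S) ×-dec ¬? (y ∈? S) ×-dec (cross x y Bool.≟ true)) ×-dec ¬? ((x Fin.≟ u) ×-dec (y Fin.≟ v)))
  ... | yes found = found
  ... | no ¬found = contradiction (≤-trans (2≤crossings S nt) (≤-trans (∑²-mono few)
      (≤-reflexive (trans (∑-*-∑ (allFin n) (allFin n) (λ x → δ x u) (λ y → δ y v)) (cong₂ _*_ (∑-δ1 u) (∑-δ1 v))))))
      λ { (s≤s ()) }
    where
    ∑-δ1 : ∀ (z : Fin n) → ∑ᶠ (λ x → δ x z) ≡ 1
    ∑-δ1 z = trans (∑-cong (allFin n) λ x → sym (*-identityʳ (δ x z))) (∑-δ (λ _ → 1) z)
    few : ∀ x y → boundary S x y * 𝟙 (cross x y) ≤ δ x u * δ y v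
    few x y with Vec.lookup S x in Sx | Vec.lookup S y in Sy | cross x y in c
    ... | false | _     | _     = z≤n
    ... | true  | true  | _     = z≤n
    ... | true  | false | false = z≤n
    ... | true  | false | true  with x Fin.≟ u | y Fin.≟ v
    ...   | yes _ | yes _ = ≤-refl
    ...   | yes _ | no ne = ⊥-elim (¬found (x , y , (lookup⇒[]= x S Sx , lookup-false⇒∉ Sy , c) , ne ∘ proj₂))
    ...   | no ne | _     = ⊥-elim (¬found (x , y , (lookup⇒[]= x S Sx , lookup-false⇒∉ Sy , c) , ne ∘ proj₁))

-- Directed paths and the alternating colouring

-- A path from `u` to `v`. The target is a parameter because paths are altered only at their start,
-- by prepending a vertex or passing to a suffix.
data SimplePath {n} (O : Arcs n) (v : Fin n) : Fin n → List (Fin n) → Set where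
  end  : SimplePath O v v (v ∷ [])
  step : ∀ {u w p} → O u w ≡ true → ¬ (u List.∈ (w ∷ p)) → SimplePath O v w (w ∷ p) → SimplePath O v u (u ∷ w ∷ p)

suffix : ∀ {n} {O : Arcs n} {v u x p} → SimplePath O v u p → x List.∈ p → ∃ (SimplePath O v x)
suffix end            (here refl) = _ , end
suffix π@(step _ _ _) (here refl) = _ , π
suffix (step _ _ π)   (there x∈)  = suffix π x∈

starts-at : ∀ {n} {O : Arcs n} {v u p} → SimplePath O v u p → ∃ λ q → p ≡ u ∷ q
starts-at end          = _ , refl
starts-at (step _ _ _) = _ , refl

-- Loop erasure: if the new first vertex already lies on the simplified rest of the walk, the suffix
-- starting there replaces the whole.
simplify : ∀ {n} {O : Arcs n} {u v} → Star (Arc O) u v → ∃ (SimplePath O v u)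
simplify stay = _ , end
simplify {u = u} (uw ◅ walk) with simplify walk
... | p , π with starts-at π
...   | q , refl with member? Fin._≟_ u p
...     | yes u∈ = suffix π u∈
...     | no u∉  = _ , step uw u∉ π

module _ {n} (G : Graph n) {O : Arcs n} (O⊆G : ∀ {x y} → O x y ≡ true → adj G x y ≡ true) where

  private
    linked : ∀ {v u p} → SimplePath O v u p → Linked (Adj G) p
    linked end           = [-]
    linked (step uw _ π) = adj⇒Adj G (O⊆G uw) ∷ linked π

    distinct : ∀ {v u p} → SimplePath O v u p → Unique p
    distinct end          = [] ∷ []
    distinct (step _ u∉ π) = ¬Any⇒All¬ _ u∉ ∷ distinct π

    ends : ∀ {v u p} → SimplePath O v u p → last p ≡ just v
    ends end          = refl
    ends (step _ _ π) = ends π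

  SimplePath⇒IsPath : ∀ {v u p} → SimplePath O v u p → IsPath G u v p
  SimplePath⇒IsPath π = record
    { linked   = linked π
    ; distinct = distinct π
    ; starts   = cong head (proj₂ (starts-at π))
    ; ends     = ends π
    }

-- Along the orientation an arc gets the side of its tail as colour, so that a directed path,
-- which changes sides at every step, alternates.
module _ {n} (G : Graph n) (side : Fin n → Bool) (O : Arcs n)
  (O⊆G : ∀ {x y} → O x y ≡ true → adj G x y ≡ true)
  (O-cross : ∀ {x y} → O x y ≡ true → side x ≢ side y)
  (one-way : ∀ {x y} → ¬ (O x y ≡ true × O y x ≡ true))
  (covering : ∀ {x y} → adj G x y ≡ true → side x ≢ side y → O x y ≡ true ⊎ O y x ≡ true) where

  private
    -- If the edge is directed from `y` to `x`, the tail is `y`. An edge with no direction does not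
    -- cross by `covering`, so its ends have equal sides and the default `side y` is symmetric too.
    tail-side : Fin n → Fin n → Bool
    tail-side x y = if O x y then side x else side y

    tail-side-comm : ∀ x y → adj G x y ≡ true → tail-side x y ≡ tail-side y x
    tail-side-comm x y xy with O x y in o | O y x in o′
    ... | true  | true  = ⊥-elim (one-way (o , o′))
    ... | true  | false = refl
    ... | false | true  = refl
    ... | false | false with side y Bool.≟ side x
    ...   | yes eq = eq
    ...   | no ne with covering xy (≢-sym ne)
    ...     | inj₁ p = case trans (sym o) p of λ ()
    ...     | inj₂ p = case trans (sym o′) p of λ ()

    toFin : Bool → Fin 2
    toFin false = zero
    toFin true  = suc zero

    toFin-injective : ∀ {a b} → toFin a ≡ toFin b → a ≡ b
    toFin-injective {true}  {true}  _ = refl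
    toFin-injective {false} {false} _ = refl

  tail-colouring : EdgeColouring G 2
  tail-colouring = record
    { colour     = λ x y → toFin (tail-side x y)
    ; colour-sym = λ x y xy → cong toFin (tail-side-comm x y (Adj⇒adj G xy))
    }

  private
    tail-side-arc : ∀ {x y} → O x y ≡ true → tail-side x y ≡ side x
    tail-side-arc o rewrite o = refl

  SimplePath⇒Proper : ∀ {v u p} → SimplePath O v u p → Proper tail-colouring p
  SimplePath⇒Proper end                            = []
  SimplePath⇒Proper (step _ _ end)                 = [-]
  SimplePath⇒Proper (step uw _ π@(step wz _ _)) =
    (λ eq → O-cross uw (trans (sym (tail-side-arc uw)) (trans (toFin-injective eq) (tail-side-arc wz)))) ∷ SimplePath⇒Proper π

-- Proper connection number two

module _ {n} (G : Graph n) (tec : ∀ S → Nontrivial S → 3 ≤ cut S G) where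

  private
    B-sym : ∀ {x y} → cross G tec x y ≡ true → cross G tec y x ≡ true
    B-sym {x} {y} p = trans (sym (cross-comm G tec x y)) p

    allPairs : List (Fin n × Fin n)
    allPairs = cartesianProduct (allFin n) (allFin n)

    open PartialOrientation (orient (cross G tec) (λ u → cong (_∧ (side G tec u xor side G tec u)) (adj-diag G u)) (cross-bridgeless G tec) B-sym allPairs)

    side′ : Fin n → Bool
    side′ = side G tec

    cross⇒ : ∀ {x y} → cross G tec x y ≡ true → adj G x y ≡ true × side′ x ≢ side′ y
    cross⇒ {x} {y} p with adj G x y | side′ x | side′ y
    cross⇒ p | true | true  | false = refl , λ ()
    cross⇒ p | true | false | true  = refl , λ ()

    ⇒cross : ∀ {x y} → adj G x y ≡ true → side′ x ≢ side′ y → cross G tec x y ≡ true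
    ⇒cross {x} {y} a ne with side′ x | side′ y
    ... | true  | true  = ⊥-elim (ne refl)
    ... | true  | false = trans (Bool.∧-identityʳ _) a
    ... | false | true  = trans (Bool.∧-identityʳ _) a
    ... | false | false = ⊥-elim (ne refl)

    one-way′ : ∀ {x y} → ¬ (arcs x y ≡ true × arcs y x ≡ true)
    one-way′ {x} {y} = one-way (∈-cartesianProduct⁺ (∈-allFin x) (∈-allFin y))

    path : ∀ u v → ∃ (SimplePath arcs v u)
    path u v = simplify (StronglyConnected⇒Star strong u v)

    O⊆G : ∀ {x y} → arcs x y ≡ true → adj G x y ≡ true
    O⊆G o = proj₁ (cross⇒ (arcs⊆B o))

  connected : Connected G
  connected u v = let p , π = path u v in p , SimplePath⇒IsPath G O⊆G π

  two-colours-suffice : ProperlyConnectable 2 G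
  two-colours-suffice =
    tail-colouring G side′ arcs O⊆G (λ o → proj₂ (cross⇒ (arcs⊆B o))) one-way′ (λ a ne → covering (⇒cross a ne)) ,
    λ u v _ → let p , π = path u v in p , SimplePath⇒IsPath G O⊆G π ,
      SimplePath⇒Proper G side′ arcs O⊆G (λ o → proj₂ (cross⇒ (arcs⊆B o))) one-way′ (λ a ne → covering (⇒cross a ne)) π

-- A path between distinct nonadjacent vertices has two consecutive edges, which a single colour
-- cannot tell apart. With no colours, not even `colour c u u` has a value.
one-colour-fails : ∀ {n} (G : Graph n) u v → u ≢ v → adj G u v ≡ false → ∀ {j} → suc j ≤ 2 → ¬ ProperlyConnectable j G
one-colour-fails G u v u≢v uv {0} _ (c , _) = case colour c u u of λ ()
one-colour-fails G u v u≢v uv {1} _ (c , pc) with pc u v u≢v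
... | [] , π , _ = case IsPath.starts π of λ ()
... | x ∷ [] , π , _ = case trans (sym (IsPath.starts π)) (IsPath.ends π) of λ { refl → u≢v refl }
... | x ∷ y ∷ [] , π , _ with IsPath.starts π | IsPath.ends π | IsPath.linked π
...   | refl | refl | xy ∷ _ = case trans (sym uv) (Adj⇒adj G xy) of λ ()
one-colour-fails G u v u≢v uv {1} _ (c , pc) | x ∷ y ∷ z ∷ p , _ , ne ∷ _ = ne (unique (colour c x y) (colour c y z))
  where
  unique : ∀ (a b : Fin 1) → a ≡ b
  unique zero zero = refl
one-colour-fails G u v u≢v uv {suc (suc j)} (s≤s (s≤s ()))

non-neighbour : ∀ {n r} (G : Graph n) → Regular r G → 2 + r ≤ n → ∀ u → ∃ λ v → u ≢ v × adj G u v ≡ false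
non-neighbour {n} {r} G reg r+2≤n u with Fin.any? (λ v → ¬? (u Fin.≟ v) ×-dec (adj G u v Bool.≟ false))
... | yes found = found
... | no ¬found = contradiction (≤-trans r+2≤n (begin
    n                             ≡⟨ trans (∑-const (allFin n) 1) (trans (*-identityʳ _) (length-tabulate id)) ⟨
    ∑ᶠ {n} (λ v → 1)              ≤⟨ ∑-mono (allFin n) covered ⟩
    ∑ᶠ (λ v → δ v u * 1 + A G u v) ≡⟨ trans (∑-+ (allFin n) (λ v → δ v u * 1) (A G u)) (cong₂ _+_ (∑-δ (λ _ → 1) u) (Regular⇒deg G reg u)) ⟩
    1 + r                         ∎)) (1+n≰n {1 + r})
  where
  open ≤-Reasoning
  covered : ∀ v → 1 ≤ δ v u * 1 + A G u v
  covered v with v Fin.≟ u | adj G u v in uv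
  ... | yes _ | _     = s≤s z≤n
  ... | no _  | true  = s≤s z≤n
  ... | no ne | false = ⊥-elim (¬found (v , ≢-sym ne , uv))

no-sparse-cut⇒pc2 : ∀ {n r} (G : Graph n) → 3 ≤ r → Regular r G → 2 + r ≤ n → ¬ SparseCut G →
                    Connected G × ProperConnectionNumber 2 G
no-sparse-cut⇒pc2 {suc n} G 3≤r reg r+2≤n ¬sparse = connected G tec , two-colours-suffice G tec ,
  (let v , ne , uv = non-neighbour G reg r+2≤n zero in one-colour-fails G zero v ne uv)
  where
  tec : ∀ S → Nontrivial S → 3 ≤ cut S G
  tec = three-edge-connected G 3≤r reg ¬sparse

-- The limit in terms of rational numbers

open import Data.Integer.Base using (+[1+_]; -[1+_])
import Data.Integer.Base as ℤ
import Data.Integer.Properties as ℤ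
import Data.Rational.Base as ℚ
import Data.Rational.Properties as ℚ
open import Data.Rational.Unnormalised.Base as ℚᵘ using (mkℚᵘ; *≡*)
import Data.Rational.Unnormalised.Properties as ℚᵘ
open import Data.Integer.Base using (+_)
open import Data.Rational.Base using (ℚ; 0ℚ; 1ℚ; _/_; _-_; ∣_∣; _<_)
open import Data.Product.Base using (∃-syntax)

-- The distance is `ρ / T`, and a positive rational is at least the reciprocal of its denominator,
-- so `ρ` times the denominator of `q` being below `T` is enough.
near-one : ∀ g ρ {T} .{{_ : NonZero T}} → g + ρ ≡ T → (q : ℚ) → 0ℚ < q →
           suc (ρ * ℚ.denominatorℕ q) ≤ T → ∣ (+ g) / T - 1ℚ ∣ < q
near-one g ρ {suc d} g+ρ q 0<q ρ<T = ℚ.toℚᵘ-cancel-< (ℚᵘ.<-respˡ-≃ (ℚᵘ.≃-sym distance) (below q 0<q ρ<T))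
  where
  numerator : ℤ.∣ + g ℤ.* ℤ.1ℤ ℤ.+ ℤ.-1ℤ ℤ.* + suc d ∣ ≡ ρ
  numerator = begin
    ℤ.∣ + g ℤ.* ℤ.1ℤ ℤ.+ ℤ.-1ℤ ℤ.* + suc d ∣ ≡⟨ cong₂ (λ i j → ℤ.∣ i ℤ.+ j ∣) (ℤ.*-identityʳ (+ g)) (ℤ.-1*i≡-i (+ suc d)) ⟩
    ℤ.∣ + g ℤ.+ ℤ.- (+ suc d) ∣              ≡⟨ cong ℤ.∣_∣ (ℤ.m-n≡m⊖n g (suc d)) ⟩
    ℤ.∣ g ℤ.⊖ suc d ∣                        ≡⟨ ℤ.∣⊖∣-≤ (≤-trans (m≤m+n g ρ) (≤-reflexive g+ρ)) ⟩
    suc d ∸ g                                ≡⟨ cong (_∸ g) g+ρ ⟨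
    g + ρ ∸ g                                ≡⟨ m+n∸m≡n g ρ ⟩
    ρ                                        ∎
    where open ≡-Reasoning

  distance : ℚ.toℚᵘ ∣ (+ g) / suc d - 1ℚ ∣ ℚᵘ.≃ mkℚᵘ (+ ρ) d
  distance = ℚᵘ.≃-trans (ℚ.toℚᵘ-homo-∣-∣ ((+ g) / suc d - 1ℚ)) (ℚᵘ.≃-trans
    (ℚᵘ.∣-∣-cong (ℚᵘ.≃-trans (ℚ.toℚᵘ-homo-+ ((+ g) / suc d) (ℚ.- 1ℚ)) (ℚᵘ.+-cong (ℚ.toℚᵘ-fromℚᵘ (mkℚᵘ (+ g) d)) ℚᵘ.≃-refl)))
    (*≡* (cong₂ (λ i j → + i ℤ.* + j) numerator (sym (*-identityʳ (suc d))))))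

  below : ∀ q → 0ℚ < q → suc (ρ * ℚ.denominatorℕ q) ≤ suc d → mkℚᵘ (+ ρ) d ℚᵘ.< ℚ.toℚᵘ q
  below (ℚ.mkℚ (+ zero)  b _) (ℚ.*<* (ℤ.+<+ ())) _
  below (ℚ.mkℚ (-[1+ a ]) b _) (ℚ.*<* ()) _
  below (ℚ.mkℚ +[1+ a ]  b _) _ h = ℚᵘ.*<* (subst₂ ℤ._<_ (ℤ.pos-* ρ (suc b)) (ℤ.pos-* (suc a) (suc d))
    (ℤ.+<+ (≤-trans h (m≤m+n (suc d) (a * suc d)))))

sparseCut? : ∀ {n} → Decidable (SparseCut {n})
sparseCut? {n} G = anySubset? λ S → (4 ≤? Subset.∣ S ∣) ×-dec (2 * Subset.∣ S ∣ ≤? n) ×-dec (cut S G ≤? 2)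

⟦⟧-split : ∀ {P Q : Set} (P? : Dec P) (Q? : Dec Q) → ⟦ P? ×-dec Q? ⟧ + ⟦ P? ×-dec ¬? Q? ⟧ ≡ ⟦ P? ⟧
⟦⟧-split (no _)  _       = refl
⟦⟧-split (yes _) (yes _) = refl
⟦⟧-split (yes _) (no _)  = refl

theorem1p7 : (r : ℕ) → 3 ≤ r →
    (ε : ℚ) → 0ℚ < ε →
    ∃[ n₀ ] (∀ n → n₀ ≤ n → .{{_ : NonZero (#regular r n)}} →
    ∣ (+ #regular-pc2 r n) / #regular r n - 1ℚ ∣ < ε)
theorem1p7 r 3≤r ε 0<ε = M₀ * 160 , λ n n₀≤n → near-one (#regular-pc2 r n) (#graphs n rest?) (total n) ε 0<ε (few n n₀≤n)
  where
  b = ℚ.denominatorℕ ε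
  -- As `M₀ ≤ M`, the summands provide `5 ≤ M`, `2 + r ≤ n`, `r * r ≤ M`, and a factor `M` larger
  -- than `K * b`, which turns `ρ * M ≤ K * T` into `ρ * b < T`.
  M₀ = 5 + r + r * r + suc (K * b)

  good? rest? : ∀ {n} (G : Graph n) → Dec _
  good? G = connected? G ×-dec properConnectionNumber? 2 G
  rest? G = regular? r G ×-dec ¬? (good? G)

  total : ∀ n → #regular-pc2 r n + #graphs n rest? ≡ #regular r n
  total n = trans (cong₂ _+_ (length-filter≡∑ (λ G → regular? r G ×-dec good? G) (graphs n)) (length-filter≡∑ rest? (graphs n)))
    (trans (sym (∑-+ (graphs n) (λ G → ⟦ regular? r G ×-dec good? G ⟧) (λ G → ⟦ rest? G ⟧)))
      (trans (∑-cong (graphs n) λ G → ⟦⟧-split (regular? r G) (good? G)) (sym (length-filter≡∑ (regular? r) (graphs n)))))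

  few : ∀ n → M₀ * 160 ≤ n → .{{_ : NonZero (#regular r n)}} → suc (#graphs n rest? * b) ≤ #regular r n
  few n n₀≤n = ≰⇒> λ T≤ρb → impossible T≤ρb
    where
    T = #regular r n
    ρ = #graphs n rest?
    M = n ℕ/./ 160

    M₀≤M : M₀ ≤ M
    M₀≤M = ≤-trans (≤-reflexive (sym (ℕ/.m*n/n≡m M₀ 160))) (ℕ/./-monoˡ-≤ 160 n₀≤n)

    160M≤n : 160 * M ≤ n
    160M≤n = ≤-trans (≤-reflexive (*-comm 160 M)) (ℕ/.m/n*n≤m n 160)

    n≤160M : n ≤ 160 * M + 160
    n≤160M = ≤-trans (≤-reflexive (trans (ℕ/.m≡m%n+[m/n]*n n 160) (trans (+-comm (n ℕ/.% 160) _) (cong (_+ n ℕ/.% 160) (*-comm M 160)))))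
      (+-monoʳ-≤ (160 * M) (<⇒≤ (ℕ/.m%n<n n 160)))

    5+r≤M : 5 + r ≤ M
    5+r≤M = ≤-trans (≤-trans (m≤m+n (5 + r) (r * r)) (m≤m+n _ _)) M₀≤M

    rest-sparse : ∀ G → Regular r G × ¬ (Connected G × ProperConnectionNumber 2 G) → Regular r G × SparseCut G
    rest-sparse G (reg , ¬good) with sparseCut? G
    ... | yes sparse = reg , sparse
    ... | no ¬sparse = ⊥-elim (¬good (no-sparse-cut⇒pc2 G 3≤r reg
      (≤-trans (+-monoˡ-≤ r (s≤s (s≤s z≤n))) (≤-trans 5+r≤M (≤-trans (m≤m+n M (159 * M)) 160M≤n))) ¬sparse))

    ρM≤KT : ρ * M ≤ K * T
    ρM≤KT = sparse-cuts-rare 3≤r (≤-trans (≤-trans (m≤n+m (r * r) (5 + r)) (m≤m+n _ _)) M₀≤M)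
      (≤-trans (m≤m+n 5 r) 5+r≤M) 160M≤n n≤160M rest? rest-sparse

    -- If T ≤ ρb then ρ(1 + Kb) ≤ ρM ≤ KT ≤ Kρb, so that ρ = 0 and T = 0.
    impossible : T ≤ ρ * b → .{{_ : NonZero T}} → ⊥
    impossible T≤ρb = 1+n≰n (≤-trans (>-nonZero⁻¹ T) (≤-trans T≤ρb (≤-reflexive (cong (_* b) ρ≡0))))
      where
      ρ≡0 : ρ ≡ 0
      ρ≡0 = n≤0⇒n≡0 (+-cancelʳ-≤ (K * (ρ * b)) ρ 0 (begin
        ρ + K * (ρ * b)   ≡⟨ solve 3 (λ ρ k b → ρ :+ k :* (ρ :* b) := ρ :* (con 1 :+ k :* b)) refl ρ K b ⟩
        ρ * suc (K * b)   ≤⟨ *-monoʳ-≤ ρ (≤-trans (m≤n+m (suc (K * b)) (5 + r + r * r)) M₀≤M) ⟩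
        ρ * M             ≤⟨ ρM≤KT ⟩
        K * T             ≤⟨ *-monoʳ-≤ K T≤ρb ⟩
        K * (ρ * b)       ∎))
        where open ≤-Reasoning
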